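{- Let $\Gamma$ be a graph with a vertex partition $\{C_1,\dots,C_6,D\}$ such that: (i) $|C_1|=\cdots=|C_6|=2$; write $C_i=\{v_{i1},v_{i2}\}$. (ii) For every vertex $v\in D$, the numbers of neighbours of $v$ in $C_1,\dots,C_6$ are all congruent modulo $2$. (iii) The adjacency matrix $B$ of the induced subgraph on $C_1\cup\dots\cup C_6$, with vertices ordered $v_{11},v_{12},v_{21},v_{22},\dots,v_{61},v_{62}$, is one of the 18 matrices $B_1,\dots,B_{18}$ listed in the context, where any $2\times 2$ block $B_{ij}$ with $i\neq j$, together with its transpose $B_{ji}$, may be replaced by its complement $J-B_{ij}$ (resp. $J-B_{ji}$). Let $\pi$ be the permutation of $C_1\cup\dots\cup C_6$ with $\pi(v_{ia})=v_{i-1,a}$ (indices $i$ modulo $6$). Construct $\Gamma'$ from $\Gamma$ on the same vertex set as follows, leaving all other adjacencies unchanged: for every $v\in D$ that has exactly one neighbour $w$ in each $C_i$, replace each such edge $\{v,w\}$ by $\{v,\pi(w)\}$; and replace the induced subgraph on $C_1\cup\dots\cup C_6$ by the one with adjacency matrix $R_{12}^TBR_{12}$ (same vertex ordering). Then $\Gamma'$ is $\mathbb{R}$-cospectral with $\Gamma$.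
   Context: Graphs are finite, simple and loopless. Two graphs with adjacency matrices $A$ and $A'$ are $\mathbb{R}$-cospectral if $A+rJ$ and $A'+rJ$ have the same spectrum for every $r\in\mathbb{R}$, where $J$ is the all-ones matrix. All blocks are $2\times 2$: $I$ identity, $J$ all-ones, $O$ zero, $Y=2I-J$, $N=\begin{bmatrix}0&0\\1&1\end{bmatrix}$, and write $n:=N^T$. $R_{12}=\frac12\,\mathrm{circulant}(J,O,O,O,O,Y)$ is the $12\times12$ matrix with $\frac12J$ in block positions $(i,i)$, $\frac12Y$ in block positions $(i,i-1)$ (indices modulo 6), and $O$ elsewhere. Each $B_k$ is the symmetric $12\times12$ matrix consisting of $6\times 6$ blocks with $B_{ii}=O$, $B_{ji}=B_{ij}^T$ and blocks above the diagonal, listed as $(B_{12},B_{13},B_{14},B_{15},B_{16}\mid B_{23},B_{24},B_{25},B_{26}\mid B_{34},B_{35},B_{36}\mid B_{45},B_{46}\mid B_{56})$: $B_1$: $(O,I,O,N,n\mid O,I,O,N\mid N,n,O\mid N,O\mid I)$ $B_2$: $(O,I,I,n,I\mid O,I,N,N\mid N,N,n\mid I,O\mid I)$ $B_3$: $(O,I,I,N,n\mid O,I,I,N\mid N,n,I\mid N,O\mid I)$ $B_4$: $(O,I,n,N,O\mid O,N,N,n\mid N,O,O\mid I,O\mid I)$ $B_5$: $(O,I,n,N,O\mid O,N,N,n\mid N,n,O\mid N,n\mid N)$ $B_6$: $(O,N,n,I,n\mid O,N,n,N\mid O,N,N\mid N,n\mid O)$ $B_7$: $(O,N,n,N,n\mid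 O,N,n,N\mid O,N,N\mid N,n\mid N)$ $B_8$: $(O,I,I,I,n\mid N,n,I,N\mid O,I,I\mid N,n\mid O)$ $B_9$: $(O,I,N,n,n\mid N,n,n,N\mid O,N,O\mid N,n\mid O)$ $B_{10}$: $(O,I,O,N,n\mid N,n,O,N\mid N,O,O\mid I,O\mid I)$ $B_{11}$: $(O,I,I,N,n\mid N,n,I,N\mid N,O,I\mid I,O\mid I)$ $B_{12}$: $(O,N,N,n,n\mid N,n,n,N\mid O,N,N\mid N,n\mid O)$ $B_{13}$: $(I,O,I,N,n\mid I,N,n,n\mid I,n,N\mid N,n\mid N)$ $B_{14}$: $(I,N,n,N,n\mid I,N,n,n\mid I,n,N\mid N,O\mid I)$ $B_{15}$: $(I,N,n,N,n\mid I,N,n,n\mid I,n,N\mid N,n\mid N)$ $B_{16}$: $(I,n,O,N,n\mid N,O,O,O\mid I,n,O\mid N,O\mid I)$ $B_{17}$: $(I,n,N,N,n\mid N,O,I,n\mid I,n,N\mid N,N\mid I)$ $B_{18}$: $(I,n,N,N,n\mid N,N,n,n\mid I,n,N\mid N,N\mid I)$ -}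

module Defs where

open import Level using (0ℓ)
open import Algebra.Bundles using (CommutativeRing; RawRing)
open import Algebra.Structures using (IsCommutativeRing)
import Algebra.Definitions.RawMonoid as RawMonoidDefinitions
open import Data.Bool.Base using (Bool; true; false; if_then_else_)
open import Data.Fin.Base as Fin using (Fin; zero; suc; quotient; remainder)
import Data.Fin.Properties as Fin
import Data.Fin.Subset as Subset
open import Data.Nat.Base as ℕ using (ℕ; zero; suc)
import Data.Nat.Properties as ℕ
open import Data.Product.Base using (∃-syntax; _×_; _,_)
open import Data.Rational.Base as ℚ using (ℚ; 0ℚ; 1ℚ; ½)
import Data.Rational.Properties as ℚ
open import Data.Rational.Solver using (module +-*-Solver)
open import Data.Vec.Base as Vec using (Vec; []; _∷_)
import Data.Vec.Recursive as Row
open import Function.Bundles using (_⇔_)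
open import Relation.Binary.PropositionalEquality
  using (_≡_; _≢_; refl; sym; trans; cong; cong₂; subst; subst₂)
open import Relation.Nullary.Decidable using (does)
open import Relation.Nullary.Negation using (¬_)

-- The real numbers are Cauchy sequences of rationals up to _≃_.
--
-- x ~ y relates sequences that are eventually arbitrarily close.  Because the two
-- indices are independent, x ~ x is the Cauchy condition.

infix 4 _~_ _≃_

record _~_ (x y : ℕ → ℚ) : Set where
  constructor mk~
  field
    near : ∀ ε → 0ℚ ℚ.< ε →
           ∃[ N ] ∀ m n → N ℕ.≤ m → N ℕ.≤ n → ℚ.∣ x m ℚ.- y n ∣ ℚ.< ε

open _~_ public

record ℝ : Set where
  constructor mkℝ
  field
    seq    : ℕ → ℚ
    cauchy : seq ~ seq

open ℝ public

record _≃_ (x y : ℝ) : Set where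
  constructor mk≃
  field
    seq~ : seq x ~ seq y

open _≃_ public

private

  ∣-∣-sym : ∀ p q → ℚ.∣ p ℚ.- q ∣ ≡ ℚ.∣ q ℚ.- p ∣
  ∣-∣-sym p q = trans (sym (ℚ.∣-p∣≡∣p∣ (p ℚ.- q))) (cong ℚ.∣_∣ (lemma p q))
    where
    open +-*-Solver
    lemma : ∀ p q → ℚ.- (p ℚ.- q) ≡ q ℚ.- p
    lemma = solve 2 (λ p q → :- (p :- q) := q :- p) refl

  ∣-∣-triangle : ∀ p q r → ℚ.∣ p ℚ.- r ∣ ℚ.≤ ℚ.∣ p ℚ.- q ∣ ℚ.+ ℚ.∣ q ℚ.- r ∣
  ∣-∣-triangle p q r = subst (ℚ._≤ ℚ.∣ p ℚ.- q ∣ ℚ.+ ℚ.∣ q ℚ.- r ∣) (cong ℚ.∣_∣ (lemma p q r))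
    (ℚ.∣p+q∣≤∣p∣+∣q∣ (p ℚ.- q) (q ℚ.- r))
    where
    open +-*-Solver
    lemma : ∀ p q r → (p ℚ.- q) ℚ.+ (q ℚ.- r) ≡ p ℚ.- r
    lemma = solve 3 (λ p q r → (p :- q) :+ (q :- r) := p :- r) refl

  half>0 : ∀ {ε} → 0ℚ ℚ.< ε → 0ℚ ℚ.< ½ ℚ.* ε
  half>0 = ℚ.*-monoʳ-<-pos ½

  half+half : ∀ ε → ½ ℚ.* ε ℚ.+ ½ ℚ.* ε ≡ ε
  half+half ε = trans (sym (ℚ.*-distribʳ-+ ε ½ ½)) (ℚ.*-identityˡ ε)

  ~-sym : ∀ {x y} → x ~ y → y ~ x
  ~-sym {x} {y} x~y = mk~ λ ε ε>0 →
    let N , close = near x~y ε ε>0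
    in N , λ m n N≤m N≤n →
         subst (ℚ._< ε) (∣-∣-sym (x n) (y m)) (close n m N≤n N≤m)

  ~-trans : ∀ {x y z} → x ~ y → y ~ z → x ~ z
  ~-trans {x} {y} {z} x~y y~z = mk~ λ ε ε>0 →
    let N₁ , close₁ = near x~y (½ ℚ.* ε) (half>0 ε>0)
        N₂ , close₂ = near y~z (½ ℚ.* ε) (half>0 ε>0)
        N = N₁ ℕ.⊔ N₂
        N₁≤N = ℕ.m≤m⊔n N₁ N₂
        N₂≤N = ℕ.m≤n⊔m N₁ N₂
    in N , λ m n N≤m N≤n →
         subst (ℚ.∣ x m ℚ.- z n ∣ ℚ.<_) (half+half ε)
           (ℚ.≤-<-trans (∣-∣-triangle (x m) (y N) (z n))
             (ℚ.+-mono-< (close₁ m N (ℕ.≤-trans N₁≤N N≤m) N₁≤N)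
                         (close₂ N n N₂≤N (ℕ.≤-trans N₂≤N N≤n))))

  ~-const : ∀ q → (λ _ → q) ~ (λ _ → q)
  ~-const q = mk~ λ ε ε>0 → 0 , λ _ _ _ _ →
    subst (λ r → ℚ.∣ r ∣ ℚ.< ε) (sym (ℚ.+-inverseʳ q)) ε>0

  ~-+ : ∀ {x x′ y y′} → x ~ x′ → y ~ y′ →
        (λ n → x n ℚ.+ y n) ~ (λ n → x′ n ℚ.+ y′ n)
  ~-+ {x} {x′} {y} {y′} x~x′ y~y′ = mk~ λ ε ε>0 →
    let N₁ , close₁ = near x~x′ (½ ℚ.* ε) (half>0 ε>0)
        N₂ , close₂ = near y~y′ (½ ℚ.* ε) (half>0 ε>0)
    in N₁ ℕ.⊔ N₂ , λ m n N≤m N≤n →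
         subst₂ ℚ._<_ (cong ℚ.∣_∣ (lemma (x m) (x′ n) (y m) (y′ n))) (half+half ε)
           (ℚ.≤-<-trans (ℚ.∣p+q∣≤∣p∣+∣q∣ (x m ℚ.- x′ n) (y m ℚ.- y′ n))
             (ℚ.+-mono-<
               (close₁ m n (ℕ.m⊔n≤o⇒m≤o N₁ N₂ N≤m) (ℕ.m⊔n≤o⇒m≤o N₁ N₂ N≤n))
               (close₂ m n (ℕ.m⊔n≤o⇒n≤o N₁ N₂ N≤m) (ℕ.m⊔n≤o⇒n≤o N₁ N₂ N≤n))))
    where
    open +-*-Solver
    lemma : ∀ p p′ q q′ →
            (p ℚ.- p′) ℚ.+ (q ℚ.- q′) ≡ (p ℚ.+ q) ℚ.- (p′ ℚ.+ q′)
    lemma = solve 4 (λ p p′ q q′ →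
      (p :- p′) :+ (q :- q′) := (p :+ q) :- (p′ :+ q′)) refl

  ~-neg : ∀ {x y} → x ~ y → (λ n → ℚ.- x n) ~ (λ n → ℚ.- y n)
  ~-neg {x} {y} x~y = mk~ λ ε ε>0 →
    let N , close = near x~y ε ε>0
    in N , λ m n N≤m N≤n →
         subst (ℚ._< ε)
           (trans (∣-∣-sym (x m) (y n)) (cong ℚ.∣_∣ (lemma (x m) (y n))))
           (close m n N≤m N≤n)
    where
    open +-*-Solver
    lemma : ∀ p q → q ℚ.- p ≡ (ℚ.- p) ℚ.- (ℚ.- q)
    lemma = solve 2 (λ p q → q :- p := (:- p) :- (:- q)) refl

  ~-bounded : ∀ {x y} → x ~ y →
              ∃[ M ] 0ℚ ℚ.< M × ∃[ N ] ∀ m → N ℕ.≤ m → ℚ.∣ x m ∣ ℚ.< M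
  ~-bounded {x} {y} x~y =
    let N , close = near x~y 1ℚ 1>0
    in 1ℚ ℚ.+ ℚ.∣ y N ∣ ,
       ℚ.+-mono-<-≤ 1>0 (ℚ.0≤∣p∣ (y N)) ,
       N , λ m N≤m →
         ℚ.≤-<-trans
           (subst (λ p → ℚ.∣ p ∣ ℚ.≤ ℚ.∣ x m ℚ.- y N ∣ ℚ.+ ℚ.∣ y N ∣) (lemma (x m) (y N))
             (ℚ.∣p+q∣≤∣p∣+∣q∣ (x m ℚ.- y N) (y N)))
           (ℚ.+-monoˡ-< ℚ.∣ y N ∣ (close m N N≤m ℕ.≤-refl))
    where
    1>0 : 0ℚ ℚ.< 1ℚ
    1>0 = ℚ.positive⁻¹ 1ℚ
    open +-*-Solver
    lemma : ∀ p q → (p ℚ.- q) ℚ.+ q ≡ p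
    lemma = solve 2 (λ p q → (p :- q) :+ q := p) refl

  shrink : ∀ {M ε} → 0ℚ ℚ.< M → 0ℚ ℚ.< ε → ∃[ δ ] 0ℚ ℚ.< δ × M ℚ.* δ ≡ ε
  shrink {M} {ε} M>0 ε>0 =
    M⁻¹ ℚ.* ε ,
    subst (ℚ._< M⁻¹ ℚ.* ε) (ℚ.*-zeroʳ M⁻¹)
      (ℚ.*-monoʳ-<-pos M⁻¹ {{ℚ.1/pos⇒pos M}} ε>0) ,
    trans (sym (ℚ.*-assoc M M⁻¹ ε))
      (trans (cong (ℚ._* ε) (ℚ.*-inverseʳ M)) (ℚ.*-identityˡ ε))
    where
    instance
      M-pos = ℚ.positive M>0
      M-nonZero = ℚ.pos⇒nonZero M
    M⁻¹ = ℚ.1/ M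

  ∣*∣-bound : ∀ {p q M δ} → ℚ.∣ p ∣ ℚ.< M → 0ℚ ℚ.< M → ℚ.∣ q ∣ ℚ.< δ →
              ℚ.∣ p ℚ.* q ∣ ℚ.< M ℚ.* δ
  ∣*∣-bound {p} {q} {M} p<M M>0 q<δ =
    subst (ℚ._< _) (sym (ℚ.∣p*q∣≡∣p∣*∣q∣ p q))
      (ℚ.≤-<-trans
        (ℚ.*-monoʳ-≤-nonNeg ℚ.∣ q ∣ {{ℚ.nonNegative (ℚ.0≤∣p∣ q)}} (ℚ.<⇒≤ p<M))
        (ℚ.*-monoʳ-<-pos M {{ℚ.positive M>0}} q<δ))

  ~-* : ∀ {x x′ y y′} → x ~ x′ → y ~ y′ →
        (λ n → x n ℚ.* y n) ~ (λ n → x′ n ℚ.* y′ n)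
  ~-* {x} {x′} {y} {y′} x~x′ y~y′ = mk~ λ ε ε>0 →
    let M₁ , M₁>0 , N₁ , bound₁ = ~-bounded x~x′
        M₂ , M₂>0 , N₂ , bound₂ = ~-bounded (~-sym y~y′)
        δ₁ , δ₁>0 , M₁δ₁ = shrink M₁>0 (half>0 ε>0)
        δ₂ , δ₂>0 , M₂δ₂ = shrink M₂>0 (half>0 ε>0)
        N₃ , close₃ = near y~y′ δ₁ δ₁>0
        N₄ , close₄ = near x~x′ δ₂ δ₂>0
        N = (N₁ ℕ.⊔ N₂) ℕ.⊔ (N₃ ℕ.⊔ N₄)
        N₁≤ = λ {k} (N≤k : N ℕ.≤ k) →
          ℕ.m⊔n≤o⇒m≤o N₁ N₂ (ℕ.m⊔n≤o⇒m≤o (N₁ ℕ.⊔ N₂) (N₃ ℕ.⊔ N₄) N≤k)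
        N₂≤ = λ {k} (N≤k : N ℕ.≤ k) →
          ℕ.m⊔n≤o⇒n≤o N₁ N₂ (ℕ.m⊔n≤o⇒m≤o (N₁ ℕ.⊔ N₂) (N₃ ℕ.⊔ N₄) N≤k)
        N₃≤ = λ {k} (N≤k : N ℕ.≤ k) →
          ℕ.m⊔n≤o⇒m≤o N₃ N₄ (ℕ.m⊔n≤o⇒n≤o (N₁ ℕ.⊔ N₂) (N₃ ℕ.⊔ N₄) N≤k)
        N₄≤ = λ {k} (N≤k : N ℕ.≤ k) →
          ℕ.m⊔n≤o⇒n≤o N₃ N₄ (ℕ.m⊔n≤o⇒n≤o (N₁ ℕ.⊔ N₂) (N₃ ℕ.⊔ N₄) N≤k)
    in N , λ m n N≤m N≤n →
         subst₂ ℚ._<_ (cong ℚ.∣_∣ (lemma (x m) (x′ n) (y m) (y′ n)))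
           (trans (cong₂ ℚ._+_ M₁δ₁ M₂δ₂) (half+half ε))
           (ℚ.≤-<-trans
             (ℚ.∣p+q∣≤∣p∣+∣q∣ (x m ℚ.* (y m ℚ.- y′ n)) (y′ n ℚ.* (x m ℚ.- x′ n)))
             (ℚ.+-mono-<
               (∣*∣-bound {x m} (bound₁ m (N₁≤ N≤m)) M₁>0
                 (close₃ m n (N₃≤ N≤m) (N₃≤ N≤n)))
               (∣*∣-bound {y′ n} (bound₂ n (N₂≤ N≤n)) M₂>0
                 (close₄ m n (N₄≤ N≤m) (N₄≤ N≤n)))))
    where
    open +-*-Solver
    lemma : ∀ p p′ q q′ →
            p ℚ.* (q ℚ.- q′) ℚ.+ q′ ℚ.* (p ℚ.- p′) ≡ p ℚ.* q ℚ.- p′ ℚ.* q′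
    lemma = solve 4 (λ p p′ q q′ →
      p :* (q :- q′) :+ q′ :* (p :- p′) := p :* q :- p′ :* q′) refl

fromℚ : ℚ → ℝ
fromℚ q = mkℝ (λ _ → q) (~-const q)

infixl 6 _+ᴿ_
infixl 7 _*ᴿ_
infix  8 -ᴿ_

_+ᴿ_ : ℝ → ℝ → ℝ
x +ᴿ y = mkℝ (λ n → seq x n ℚ.+ seq y n) (~-+ (cauchy x) (cauchy y))

_*ᴿ_ : ℝ → ℝ → ℝ
x *ᴿ y = mkℝ (λ n → seq x n ℚ.* seq y n) (~-* (cauchy x) (cauchy y))

-ᴿ_ : ℝ → ℝ
-ᴿ x = mkℝ (λ n → ℚ.- seq x n) (~-neg (cauchy x))

pointwise : ∀ {x y} → (∀ n → seq x n ≡ seq y n) → x ≃ y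
pointwise {x} {y} x≡y = mk≃ (mk~ λ ε ε>0 →
  let N , close = near (cauchy x) ε ε>0
  in N , λ m n N≤m N≤n →
       subst (λ q → ℚ.∣ seq x m ℚ.- q ∣ ℚ.< ε) (x≡y n) (close m n N≤m N≤n))

ℝ-isCommutativeRing : IsCommutativeRing _≃_ _+ᴿ_ _*ᴿ_ -ᴿ_ (fromℚ 0ℚ) (fromℚ 1ℚ)
ℝ-isCommutativeRing = record
  { isRing = record
    { +-isAbelianGroup = record
      { isGroup = record
        { isMonoid = record
          { isSemigroup = record
            { isMagma = record
              { isEquivalence = record
                { refl  = λ {x} → mk≃ (cauchy x)
                ; sym   = λ p → mk≃ (~-sym (seq~ p))
                ; trans = λ p q → mk≃ (~-trans (seq~ p) (seq~ q))
                }
              ; ∙-cong = λ p q → mk≃ (~-+ (seq~ p) (seq~ q))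
              }
            ; assoc = λ x y z → pointwise λ n → ℚ.+-assoc (seq x n) (seq y n) (seq z n)
            }
          ; identity = (λ x → pointwise λ n → ℚ.+-identityˡ (seq x n))
                     , (λ x → pointwise λ n → ℚ.+-identityʳ (seq x n))
          }
        ; inverse = (λ x → pointwise λ n → ℚ.+-inverseˡ (seq x n))
                  , (λ x → pointwise λ n → ℚ.+-inverseʳ (seq x n))
        ; ⁻¹-cong = λ p → mk≃ (~-neg (seq~ p))
        }
      ; comm = λ x y → pointwise λ n → ℚ.+-comm (seq x n) (seq y n)
      }
    ; *-cong = λ p q → mk≃ (~-* (seq~ p) (seq~ q))
    ; *-assoc = λ x y z → pointwise λ n → ℚ.*-assoc (seq x n) (seq y n) (seq z n)
    ; *-identity = (λ x → pointwise λ n → ℚ.*-identityˡ (seq x n))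
                 , (λ x → pointwise λ n → ℚ.*-identityʳ (seq x n))
    ; distrib = (λ x y z → pointwise λ n →
                   ℚ.*-distribˡ-+ (seq x n) (seq y n) (seq z n))
              , (λ x y z → pointwise λ n →
                   ℚ.*-distribʳ-+ (seq x n) (seq y n) (seq z n))
    }
  ; *-comm = λ x y → pointwise λ n → ℚ.*-comm (seq x n) (seq y n)
  }

ℝ-commutativeRing : CommutativeRing 0ℓ 0ℓ
ℝ-commutativeRing = record { isCommutativeRing = ℝ-isCommutativeRing }

module Matrices (R : RawRing 0ℓ 0ℓ) where

  open RawRing R
  open RawMonoidDefinitions +-rawMonoid public using (sum)

  infix  9 _ᵀ
  infixl 7 _*ᴹ_ _*ᵛ_ _·ᴹ_
  infixl 6 _+ᴹ_ _-ᴹ_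

  Vector : ℕ → Set
  Vector n = Fin n → Carrier

  Matrix : ℕ → ℕ → Set
  Matrix m n = Fin m → Fin n → Carrier

  _ᵀ : ∀ {m n} → Matrix m n → Matrix n m
  (A ᵀ) i j = A j i

  _+ᴹ_ _-ᴹ_ : ∀ {m n} → Matrix m n → Matrix m n → Matrix m n
  (A +ᴹ B) i j = A i j + B i j
  (A -ᴹ B) i j = A i j + - B i j

  _·ᴹ_ : ∀ {m n} → Carrier → Matrix m n → Matrix m n
  (c ·ᴹ A) i j = c * A i j

  _*ᴹ_ : ∀ {l m n} → Matrix l m → Matrix m n → Matrix l n
  (A *ᴹ B) i j = sum λ k → A i k * B k j

  _*ᵛ_ : ∀ {m n} → Matrix m n → Vector n → Vector m
  (A *ᵛ v) i = sum λ k → A i k * v k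

  allOnes : ∀ {m n} → Matrix m n
  allOnes _ _ = 1#

  linearCombination : ∀ {k n} → Vector k → (Fin k → Vector n) → Vector n
  linearCombination c b x = sum λ i → c i * b i x

  -- The eigenspace of A for λ₀ has dimension k.  Since only symmetric real
  -- matrices occur below, this is the multiplicity of λ₀ in the spectrum;
  -- k = 0 says that λ₀ is not an eigenvalue.
  record HasMultiplicity {n} (A : Matrix n n) (λ₀ : Carrier) (k : ℕ) : Set where
    field
      basis       : Fin k → Vector n
      eigen       : ∀ i x → (A *ᵛ basis i) x ≈ λ₀ * basis i x
      independent : ∀ c → (∀ x → linearCombination c basis x ≈ 0#) →
                    ∀ i → c i ≈ 0#
      spanning    : ∀ v → (∀ x → (A *ᵛ v) x ≈ λ₀ * v x) →
                    ∃[ c ] ∀ x → v x ≈ linearCombination c basis x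

  SameSpectrum : ∀ {n} → Matrix n n → Matrix n n → Set
  SameSpectrum A A′ = ∀ λ₀ k → HasMultiplicity A λ₀ k ⇔ HasMultiplicity A′ λ₀ k

module Mℚ = Matrices ℚ.+-*-rawRing
module Mℝ = Matrices (CommutativeRing.rawRing ℝ-commutativeRing)

record Graph (n : ℕ) : Set where
  field
    adj       : Fin n → Fin n → Bool
    symmetric : ∀ x y → adj x y ≡ adj y x
    loopless  : ∀ x → adj x x ≡ false

open Graph public

adjacencyℚ : ∀ {n} → Graph n → Mℚ.Matrix n n
adjacencyℚ Γ x y = if adj Γ x y then 1ℚ else 0ℚ

adjacencyℝ : ∀ {n} → Graph n → Mℝ.Matrix n n
adjacencyℝ Γ x y = fromℚ (adjacencyℚ Γ x y)

infix 4 _ℝ-Cospectral_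

_ℝ-Cospectral_ : ∀ {n} → Graph n → Graph n → Set
Γ ℝ-Cospectral Γ′ =
  ∀ r → SameSpectrum (adjacencyℝ Γ +ᴹ r ·ᴹ allOnes) (adjacencyℝ Γ′ +ᴹ r ·ᴹ allOnes)
  where open Mℝ

open Mℚ

Block : Set
Block = Matrix 2 2

block : ℚ → ℚ → ℚ → ℚ → Block
block a b c d zero       zero       = a
block a b c d zero       (suc zero) = b
block a b c d (suc zero) zero       = c
block a b c d (suc zero) (suc zero) = d

module Blocks where

  I J O Y N n : Block
  I = block 1ℚ 0ℚ
            0ℚ 1ℚ
  J = allOnes
  O = block 0ℚ 0ℚ
            0ℚ 0ℚ
  Y = (1ℚ ℚ.+ 1ℚ) ·ᴹ I -ᴹ J
  N = block 0ℚ 0ℚ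
            1ℚ 1ℚ
  n = N ᵀ

open Blocks

-- Position 2i + a of a 12 × 12 matrix is position a of block i.
fromBlocks : (Fin 6 → Fin 6 → Block) → Matrix 12 12
fromBlocks B p q =
  B (quotient 2 p) (quotient 2 q) (remainder {6} 2 p) (remainder {6} 2 q)

-- i ↦ i - 1 modulo 6
pred₆ : Fin 6 → Fin 6
pred₆ zero    = Fin.fromℕ 5
pred₆ (suc i) = Fin.inject₁ i

R₁₂ : Matrix 12 12
R₁₂ = fromBlocks λ i j →
  if does (j Fin.≟ i)       then ½ ·ᴹ J else
  if does (j Fin.≟ pred₆ i) then ½ ·ᴹ Y else
  O

-- The entries above the diagonal of an m × m array, listed row by row.
infixr 5 _⨾_

data Triangle (A : Set) : ℕ → Set where
  end : Triangle A 1
  _⨾_ : ∀ {m} → A Row.^ suc m → Triangle A (suc m) → Triangle A (suc (suc m))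

symmetricBlocks : ∀ {m} → Triangle Block m → Fin m → Fin m → Block
symmetricBlocks end     zero    zero    = O
symmetricBlocks (r ⨾ t) zero    zero    = O
symmetricBlocks (r ⨾ t) zero    (suc j) = Row.lookup r j
symmetricBlocks (r ⨾ t) (suc i) zero    = Row.lookup r i ᵀ
symmetricBlocks (r ⨾ t) (suc i) (suc j) = symmetricBlocks t i j

complementWhere : ∀ {m} → Triangle Bool m → Triangle Block m → Triangle Block m
complementWhere end     end     = end
complementWhere (c ⨾ s) (r ⨾ t) =
  Row.zipWith (λ c B → if c then J -ᴹ B else B) _ c r ⨾ complementWhere s t

blocks : Vec (Triangle Block 6) 18
blocks =
    ((O , I , O , N , n) ⨾ (O , I , O , N) ⨾ (N , n , O) ⨾ (N , O) ⨾ I ⨾ end)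
  ∷ ((O , I , I , n , I) ⨾ (O , I , N , N) ⨾ (N , N , n) ⨾ (I , O) ⨾ I ⨾ end)
  ∷ ((O , I , I , N , n) ⨾ (O , I , I , N) ⨾ (N , n , I) ⨾ (N , O) ⨾ I ⨾ end)
  ∷ ((O , I , n , N , O) ⨾ (O , N , N , n) ⨾ (N , O , O) ⨾ (I , O) ⨾ I ⨾ end)
  ∷ ((O , I , n , N , O) ⨾ (O , N , N , n) ⨾ (N , n , O) ⨾ (N , n) ⨾ N ⨾ end)
  ∷ ((O , N , n , I , n) ⨾ (O , N , n , N) ⨾ (O , N , N) ⨾ (N , n) ⨾ O ⨾ end)
  ∷ ((O , N , n , N , n) ⨾ (O , N , n , N) ⨾ (O , N , N) ⨾ (N , n) ⨾ N ⨾ end)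
  ∷ ((O , I , I , I , n) ⨾ (N , n , I , N) ⨾ (O , I , I) ⨾ (N , n) ⨾ O ⨾ end)
  ∷ ((O , I , N , n , n) ⨾ (N , n , n , N) ⨾ (O , N , O) ⨾ (N , n) ⨾ O ⨾ end)
  ∷ ((O , I , O , N , n) ⨾ (N , n , O , N) ⨾ (N , O , O) ⨾ (I , O) ⨾ I ⨾ end)
  ∷ ((O , I , I , N , n) ⨾ (N , n , I , N) ⨾ (N , O , I) ⨾ (I , O) ⨾ I ⨾ end)
  ∷ ((O , N , N , n , n) ⨾ (N , n , n , N) ⨾ (O , N , N) ⨾ (N , n) ⨾ O ⨾ end)
  ∷ ((I , O , I , N , n) ⨾ (I , N , n , n) ⨾ (I , n , N) ⨾ (N , n) ⨾ N ⨾ end)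
  ∷ ((I , N , n , N , n) ⨾ (I , N , n , n) ⨾ (I , n , N) ⨾ (N , O) ⨾ I ⨾ end)
  ∷ ((I , N , n , N , n) ⨾ (I , N , n , n) ⨾ (I , n , N) ⨾ (N , n) ⨾ N ⨾ end)
  ∷ ((I , n , O , N , n) ⨾ (N , O , O , O) ⨾ (I , n , O) ⨾ (N , O) ⨾ I ⨾ end)
  ∷ ((I , n , N , N , n) ⨾ (N , O , I , n) ⨾ (I , n , N) ⨾ (N , N) ⨾ I ⨾ end)
  ∷ ((I , n , N , N , n) ⨾ (N , N , n , n) ⨾ (I , n , N) ⨾ (N , N) ⨾ I ⨾ end)
  ∷ []

-- B k with the blocks selected by c, and their transposes, complemented.
B : Fin 18 → Triangle Bool 6 → Matrix 12 12
B k c = fromBlocks (symmetricBlocks (complementWhere c (Vec.lookup blocks k)))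

-- The vertices v_{ia} of C₁ ∪ … ∪ C₆; D is the set of remaining vertices,
-- and may be empty.
module Switching {m} (Γ : Graph m) (v : Fin 6 → Fin 2 → Fin m) where

  D : Fin m → Set
  D x = ∀ i a → x ≢ v i a

  degreeInto : Fin 6 → Fin m → ℕ
  degreeInto i x = Subset.∣ Vec.tabulate (λ a → adj Γ x (v i a)) ∣

  OneNeighbourInEach : Fin m → Set
  OneNeighbourInEach x = ∀ i → degreeInto i x ≡ 1

  vertex : Fin 12 → Fin m
  vertex p = v (quotient 2 p) (remainder {6} 2 p)

  induced : Graph m → Matrix 12 12
  induced Δ p q = adjacencyℚ Δ (vertex p) (vertex q)

  record IsSwitched (Γ′ : Graph m) : Set where
    field
      outside   : ∀ {x y} → D x → D y → adj Γ′ x y ≡ adj Γ x y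
      switched  : ∀ {x} → D x → OneNeighbourInEach x →
                  ∀ i a → adj Γ′ x (v (pred₆ i) a) ≡ adj Γ x (v i a)
      unchanged : ∀ {x} → D x → ¬ OneNeighbourInEach x →
                  ∀ i a → adj Γ′ x (v i a) ≡ adj Γ x (v i a)
      inside    : ∀ p q → induced Γ′ p q ≡ (R₁₂ ᵀ *ᴹ induced Γ *ᴹ R₁₂) p q

{-# OPTIONS --safe #-}
module Submission where

open import Defs
open import Level using (0ℓ)
open import Algebra.Bundles using (CommutativeRing)
open import Algebra.Morphism.Structures using (IsRingHomomorphism)
import Algebra.Properties.CommutativeSemigroup as CommutativeSemigroupProperties
import Algebra.Properties.Semiring.Sum as SemiringSum
open import Data.Bool.Base using (Bool; true; false; if_then_else_)
open import Data.Fin.Base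
  using (Fin; zero; suc; _↑ˡ_; _↑ʳ_; combine; opposite; quotient; remainder; remQuot)
import Data.Fin.Properties as Fin
import Data.Fin.Subset as Subset
open import Data.Maybe.Base using (Maybe; just; nothing)
open import Data.Nat.Base as ℕ using (ℕ; zero; suc)
open import Data.Nat.DivMod using (_%_)
import Data.Nat.Properties as ℕ
open import Data.Product.Base using (∃-syntax; _×_; _,_; uncurry)
open import Data.Rational.Base as ℚ using (ℚ; 0ℚ; 1ℚ; ½)
import Data.Rational.Properties as ℚ
open import Data.Rational.Solver using (module +-*-Solver)
open import Data.Sum.Base using (_⊎_; inj₁; inj₂)
import Data.Vec.Base as Vec
import Data.Vec.Recursive as Row
open import Function.Base using (_∘_)
open import Function.Definitions using (Injective)
import Relation.Binary.PropositionalEquality as ≡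
open import Relation.Binary.PropositionalEquality using (_≡_; _≢_)
import Relation.Binary.Reasoning.Setoid as SetoidReasoning
open import Relation.Nullary.Decidable
  using (Dec; yes; no; does; toWitness; dec-true; dec-false; _⊎-dec_)
open import Relation.Nullary.Negation using (contradiction)

-- Let Q act as R₁₂ on C₁ ∪ … ∪ C₆ and as the identity on D.  It is a rational orthogonal
-- matrix with column sums 1, so Qᵀ(A + rJ)Q = QᵀAQ + rJ, and Q carries eigenspaces to
-- eigenspaces.  That QᵀAQ is the adjacency matrix of Γ′ is clear inside D and inside
-- C₁ ∪ … ∪ C₆.  For a row of A indexed by D, let x and y be its parts in C_i and C_{i+1},
-- and e = (1,1), f = (1,-1); the new part in C_i is ½(x·e)e + ½(y·f)f, which is y when all
-- parts have exactly one 1, and x when all parts are constant.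
--
-- Γ′ exists because R₁₂ᵀBR₁₂ is a 0-1 matrix: for every block X of B, X - ½J is ±½ times
-- one of eeᵀ, efᵀ, feᵀ, ffᵀ, and complementation only changes the sign.  Block (i,j) of
-- R₁₂ᵀBR₁₂ - ½J collects the eeᵀ, efᵀ, feᵀ, ffᵀ parts of the blocks (i,j), (i,j+1),
-- (i+1,j), (i+1,j+1), and for each B_k exactly one of these four parts is nonzero.

-- Matrix algebra over a commutative ring.

module MatrixProperties (R : CommutativeRing 0ℓ 0ℓ) where

  open CommutativeRing R
  open Matrices rawRing hiding (sum)
  open SemiringSum semiring
  open SetoidReasoning setoid
  open CommutativeSemigroupProperties *-commutativeSemigroup using (x∙yz≈y∙xz)

  infix 4 _≋_

  _≋_ : ∀ {m n} → Matrix m n → Matrix m n → Set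
  A ≋ B = ∀ i j → A i j ≈ B i j

  δ : ∀ {n} → Matrix n n
  δ i j = if does (i Fin.≟ j) then 1# else 0#

  δ-refl : ∀ {n} (i : Fin n) → δ i i ≡ 1#
  δ-refl zero    = ≡.refl
  δ-refl (suc i) = δ-refl i

  δ-sym : ∀ {n} (i j : Fin n) → δ i j ≡ δ j i
  δ-sym zero    zero    = ≡.refl
  δ-sym zero    (suc j) = ≡.refl
  δ-sym (suc i) zero    = ≡.refl
  δ-sym (suc i) (suc j) = δ-sym i j

  sum-zero : ∀ {n} (t : Vector n) → (∀ i → t i ≈ 0#) → sum t ≈ 0#
  sum-zero {n} t t≈0 = trans (sum-cong-≋ t≈0) (sum-replicate-zero n)

  sum-δ : ∀ {n} i (v : Vector n) → ∑[ j < n ] (δ i j * v j) ≈ v i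
  sum-δ zero    v = trans
    (+-cong (*-identityˡ _) (sum-zero _ λ j → zeroˡ (v (suc j))))
    (+-identityʳ _)
  sum-δ (suc i) v = trans
    (+-cong (zeroˡ _) (sum-δ i (v ∘ suc)))
    (+-identityˡ _)

  sum-↑ : ∀ m {n} (t : Vector (m ℕ.+ n)) →
          sum t ≈ sum (λ i → t (i ↑ˡ n)) + sum (λ j → t (m ↑ʳ j))
  sum-↑ zero    t = sym (+-identityˡ _)
  sum-↑ (suc m) t = trans (+-congˡ (sum-↑ m (t ∘ suc))) (sym (+-assoc _ _ _))

  sum-combine : ∀ m n (t : Vector (m ℕ.* n)) →
                sum t ≈ ∑[ i < m ] ∑[ j < n ] t (combine i j)
  sum-combine zero    n t = refl
  sum-combine (suc m) n t =
    trans (sum-↑ n t) (+-congˡ (sum-combine m n (t ∘ (n ↑ʳ_))))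

  *ᵛ-cong : ∀ {m n} {A B : Matrix m n} {v w : Vector n} →
            A ≋ B → (∀ j → v j ≈ w j) → ∀ i → (A *ᵛ v) i ≈ (B *ᵛ w) i
  *ᵛ-cong A≋B v≈w i = sum-cong-≋ λ j → *-cong (A≋B i j) (v≈w j)

  *ᴹ-cong : ∀ {l m n} {A A′ : Matrix l m} {B B′ : Matrix m n} →
            A ≋ A′ → B ≋ B′ → A *ᴹ B ≋ A′ *ᴹ B′
  *ᴹ-cong A≋A′ B≋B′ i j = *ᵛ-cong A≋A′ (λ k → B≋B′ k j) i

  conjugate-cong : ∀ {m n} (P : Matrix n m) {A A′} (Q : Matrix m n) →
                   A ≋ A′ → P *ᴹ A *ᴹ Q ≋ P *ᴹ A′ *ᴹ Q
  conjugate-cong P Q A≋A′ =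
    *ᴹ-cong {B = Q} (*ᴹ-cong {A = P} (λ _ _ → refl) A≋A′) λ _ _ → refl

  *ᵛ-congˡ : ∀ {m n} (A : Matrix m n) {v w : Vector n} →
             (∀ j → v j ≈ w j) → ∀ i → (A *ᵛ v) i ≈ (A *ᵛ w) i
  *ᵛ-congˡ A = *ᵛ-cong {A = A} λ _ _ → refl

  *ᵛ-assoc : ∀ {l m n} (A : Matrix l m) (B : Matrix m n) v i →
             (A *ᴹ B *ᵛ v) i ≈ (A *ᵛ (B *ᵛ v)) i
  *ᵛ-assoc {l} {m} {n} A B v i = begin
    ∑[ k < n ] (∑[ j < m ] (A i j * B j k) * v k)    ≈⟨ sum-cong-≋ (λ k → *-distribʳ-sum (v k) (λ j → A i j * B j k)) ⟩
    ∑[ k < n ] ∑[ j < m ] (A i j * B j k * v k)      ≈⟨ ∑-comm (λ k j → A i j * B j k * v k) ⟩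
    ∑[ j < m ] ∑[ k < n ] (A i j * B j k * v k)      ≈⟨ sum-cong-≋ (λ j → sum-cong-≋ λ k → *-assoc (A i j) (B j k) (v k)) ⟩
    ∑[ j < m ] ∑[ k < n ] (A i j * (B j k * v k))    ≈⟨ sum-cong-≋ (λ j → *-distribˡ-sum (A i j) (λ k → B j k * v k)) ⟨
    ∑[ j < m ] (A i j * ∑[ k < n ] (B j k * v k))    ∎

  *ᵛ-scale : ∀ {m n} (A : Matrix m n) c v i →
             (A *ᵛ (λ j → c * v j)) i ≈ c * (A *ᵛ v) i
  *ᵛ-scale A c v i = begin
    sum (λ j → A i j * (c * v j))   ≈⟨ sum-cong-≋ (λ j → x∙yz≈y∙xz (A i j) c (v j)) ⟩
    sum (λ j → c * (A i j * v j))   ≈⟨ *-distribˡ-sum c (λ j → A i j * v j) ⟨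
    c * sum (λ j → A i j * v j)     ∎

  linearCombination≈*ᵛ : ∀ {k n} (c : Vector k) (b : Fin k → Vector n) x →
                         linearCombination c b x ≈ (b ᵀ *ᵛ c) x
  linearCombination≈*ᵛ c b x = sum-cong-≋ λ i → *-comm (c i) (b i x)

  -- With the vectors `b i` as columns of `b ᵀ`, linearity of A becomes associativity of the
  -- product.
  *ᵛ-linearCombination : ∀ {k m n} (A : Matrix m n) (c : Vector k) b x →
    (A *ᵛ linearCombination c b) x ≈ linearCombination c (λ i → A *ᵛ b i) x
  *ᵛ-linearCombination A c b x = begin
    (A *ᵛ linearCombination c b) x          ≈⟨ *ᵛ-congˡ A (linearCombination≈*ᵛ c b) x ⟩
    (A *ᵛ (b ᵀ *ᵛ c)) x                     ≈⟨ *ᵛ-assoc A (b ᵀ) c x ⟨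
    (A *ᴹ b ᵀ *ᵛ c) x                       ≈⟨ linearCombination≈*ᵛ c (λ i → A *ᵛ b i) x ⟨
    linearCombination c (λ i → A *ᵛ b i) x  ∎

  conjugate-affine : ∀ {k l m n} (P : Matrix k l) (A B : Matrix l m) r (Q : Matrix m n) →
    P *ᴹ (A +ᴹ r ·ᴹ B) *ᴹ Q ≋ (P *ᴹ A *ᴹ Q) +ᴹ r ·ᴹ (P *ᴹ B *ᴹ Q)
  conjugate-affine P A B r Q x y = begin
    (P *ᴹ (A +ᴹ r ·ᴹ B) *ᴹ Q) x y
      ≈⟨ sum-cong-≋ (λ j → trans (*-congʳ (left j)) (distribʳ _ _ _)) ⟩
    sum (λ j → (P *ᴹ A) x j * Q j y + r * (P *ᴹ B) x j * Q j y)
      ≈⟨ ∑-distrib-+ (λ j → (P *ᴹ A) x j * Q j y) _ ⟩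
    (P *ᴹ A *ᴹ Q) x y + sum (λ j → r * (P *ᴹ B) x j * Q j y)
      ≈⟨ +-congˡ (trans (sum-cong-≋ λ j → *-assoc r ((P *ᴹ B) x j) (Q j y))
                       (sym (*-distribˡ-sum r (λ j → (P *ᴹ B) x j * Q j y)))) ⟩
    (P *ᴹ A *ᴹ Q) x y + r * (P *ᴹ B *ᴹ Q) x y
      ∎
    where
    left : ∀ j → (P *ᴹ (A +ᴹ r ·ᴹ B)) x j ≈ (P *ᴹ A) x j + r * (P *ᴹ B) x j
    left j = begin
      sum (λ i → P x i * (A i j + r * B i j))
        ≈⟨ sum-cong-≋ (λ i → distribˡ (P x i) _ _) ⟩
      sum (λ i → P x i * A i j + P x i * (r * B i j))
        ≈⟨ ∑-distrib-+ (λ i → P x i * A i j) _ ⟩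
      (P *ᴹ A) x j + sum (λ i → P x i * (r * B i j))
        ≈⟨ +-congˡ (*ᵛ-scale P r (λ i → B i j) x) ⟩
      (P *ᴹ A) x j + r * (P *ᴹ B) x j
        ∎

  -- Similar matrices and their eigenspaces.

  -- Stated through the action on vectors, the form in which eigenspaces are transported.
  record Similar {n} (A A′ : Matrix n n) : Set where
    field
      P Q  : Matrix n n
      QP≈v : ∀ v x → (Q *ᵛ (P *ᵛ v)) x ≈ v x
      PQ≈v : ∀ v x → (P *ᵛ (Q *ᵛ v)) x ≈ v x
      A′≈PAQ : ∀ v x → (A′ *ᵛ v) x ≈ (P *ᵛ (A *ᵛ (Q *ᵛ v))) x

  conjugate⇒similar : ∀ {n} {A A′ P Q : Matrix n n} →
    Q *ᴹ P ≋ δ → P *ᴹ Q ≋ δ → A′ ≋ P *ᴹ A *ᴹ Q → Similar A A′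
  conjugate⇒similar {n} {A} {A′} {P} {Q} QP≋δ PQ≋δ A′≋PAQ = record
    { P      = P
    ; Q      = Q
    ; QP≈v   = cancel Q P QP≋δ
    ; PQ≈v   = cancel P Q PQ≋δ
    ; A′≈PAQ = λ v x → begin
        (A′ *ᵛ v) x               ≈⟨ *ᵛ-cong A′≋PAQ (λ _ → refl) x ⟩
        (P *ᴹ A *ᴹ Q *ᵛ v) x      ≈⟨ *ᵛ-assoc (P *ᴹ A) Q v x ⟩
        (P *ᴹ A *ᵛ (Q *ᵛ v)) x    ≈⟨ *ᵛ-assoc P A (Q *ᵛ v) x ⟩
        (P *ᵛ (A *ᵛ (Q *ᵛ v))) x  ∎
    }
    where
    cancel : ∀ (P Q : Matrix n n) → P *ᴹ Q ≋ δ → ∀ v x → (P *ᵛ (Q *ᵛ v)) x ≈ v x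
    cancel P Q PQ≋δ v x = begin
      (P *ᵛ (Q *ᵛ v)) x  ≈⟨ *ᵛ-assoc P Q v x ⟨
      (P *ᴹ Q *ᵛ v) x    ≈⟨ *ᵛ-cong PQ≋δ (λ _ → refl) x ⟩
      (δ *ᵛ v) x         ≈⟨ sum-δ x v ⟩
      v x                ∎

  -- Since QP = 1, A = QPAQP, and PAQ is `A′`; hence A = Q`A′`P.
  similar-sym : ∀ {n} {A A′ : Matrix n n} → Similar A A′ → Similar A′ A
  similar-sym {A = A} {A′} s = record
    { P      = Q
    ; Q      = P
    ; QP≈v   = PQ≈v
    ; PQ≈v   = QP≈v
    ; A′≈PAQ = λ v x → begin
        (A *ᵛ v) x                                ≈⟨ *ᵛ-congˡ A (QP≈v v) x ⟨
        (A *ᵛ (Q *ᵛ (P *ᵛ v))) x                  ≈⟨ QP≈v (A *ᵛ (Q *ᵛ (P *ᵛ v))) x ⟨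
        (Q *ᵛ (P *ᵛ (A *ᵛ (Q *ᵛ (P *ᵛ v))))) x    ≈⟨ *ᵛ-congˡ Q (A′≈PAQ (P *ᵛ v)) x ⟨
        (Q *ᵛ (A′ *ᵛ (P *ᵛ v))) x                 ∎
    }
    where open Similar s

  -- P maps the eigenspace of A onto that of `A′`. Independence follows by applying Q to a vanishing
  -- combination. For spanning, Qv is an eigenvector of A; P takes its expansion to one of v.
  similar⇒hasMultiplicity : ∀ {n} {A A′ : Matrix n n} → Similar A A′ →
    ∀ {λ₀ k} → HasMultiplicity A λ₀ k → HasMultiplicity A′ λ₀ k
  similar⇒hasMultiplicity {A = A} {A′} s {λ₀} h = record
    { basis       = λ i → P *ᵛ basis i
    ; eigen       = λ i x → begin
        (A′ *ᵛ (P *ᵛ basis i)) x                ≈⟨ A′≈PAQ (P *ᵛ basis i) x ⟩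
        (P *ᵛ (A *ᵛ (Q *ᵛ (P *ᵛ basis i)))) x   ≈⟨ *ᵛ-congˡ P (*ᵛ-congˡ A (QP≈v (basis i))) x ⟩
        (P *ᵛ (A *ᵛ basis i)) x                 ≈⟨ *ᵛ-congˡ P (eigen i) x ⟩
        (P *ᵛ (λ y → λ₀ * basis i y)) x         ≈⟨ *ᵛ-scale P λ₀ (basis i) x ⟩
        λ₀ * (P *ᵛ basis i) x                   ∎
    ; independent = λ c c≈0 → independent c λ x → begin
        linearCombination c basis x                 ≈⟨ QP≈v (linearCombination c basis) x ⟨
        (Q *ᵛ (P *ᵛ linearCombination c basis)) x   ≈⟨ *ᵛ-congˡ Q (λ y → trans (*ᵛ-linearCombination P c basis y) (c≈0 y)) x ⟩
        (Q *ᵛ (λ _ → 0#)) x                         ≈⟨ sum-zero _ (λ y → zeroʳ (Q x y)) ⟩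
        0#                                          ∎
    ; spanning    = λ v A′v≈λv →
        let c , Qv≈ = spanning (Q *ᵛ v) λ x → begin
              (A *ᵛ (Q *ᵛ v)) x                ≈⟨ QP≈v (A *ᵛ (Q *ᵛ v)) x ⟨
              (Q *ᵛ (P *ᵛ (A *ᵛ (Q *ᵛ v)))) x  ≈⟨ *ᵛ-congˡ Q (λ y → trans (sym (A′≈PAQ v y)) (A′v≈λv y)) x ⟩
              (Q *ᵛ (λ y → λ₀ * v y)) x        ≈⟨ *ᵛ-scale Q λ₀ v x ⟩
              λ₀ * (Q *ᵛ v) x                  ∎
        in c , λ x → begin
          v x                                          ≈⟨ PQ≈v v x ⟨
          (P *ᵛ (Q *ᵛ v)) x                            ≈⟨ *ᵛ-congˡ P Qv≈ x ⟩
          (P *ᵛ linearCombination c basis) x           ≈⟨ *ᵛ-linearCombination P c basis x ⟩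
          linearCombination c (λ i → P *ᵛ basis i) x   ∎
    }
    where
    open Similar s
    open HasMultiplicity h

-- Transport of rational matrix identities along a ring homomorphism.

open ≡ hiding (J)
open Mℚ hiding (sum)
open MatrixProperties ℚ.+-*-commutativeRing
open SemiringSum (CommutativeRing.semiring ℚ.+-*-commutativeRing)

-- The identities for the switching matrix hold over the rationals, where they can be decided by
-- evaluation; only r, the eigenvalues and the eigenvectors live in `R`.
module ScalarExtension (R : CommutativeRing 0ℓ 0ℓ) {f : ℚ → CommutativeRing.Carrier R}
  (f-homo : IsRingHomomorphism ℚ.+-*-rawRing (CommutativeRing.rawRing R) f) where

  private
    module R = CommutativeRing R
    module MR = Matrices R.rawRing
    module RP = MatrixProperties R
    module RS = SemiringSum R.semiring
  open IsRingHomomorphism f-homo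

  map : ∀ {m n} → Matrix m n → MR.Matrix m n
  map A i j = f (A i j)

  map-cong : ∀ {m n} {A B : Matrix m n} → A ≋ B → map A RP.≋ map B
  map-cong A≋B i j = ⟦⟧-cong (A≋B i j)

  sum-homo : ∀ {n} (t : Mℚ.Vector n) → f (Mℚ.sum t) R.≈ MR.sum (f ∘ t)
  sum-homo {zero}  t = 0#-homo
  sum-homo {suc n} t = R.trans (+-homo _ _) (R.+-congˡ (sum-homo (t ∘ suc)))

  map-*ᴹ : ∀ {l m n} (A : Matrix l m) (B : Matrix m n) → map (A *ᴹ B) RP.≋ map A MR.*ᴹ map B
  map-*ᴹ A B i j = R.trans (sum-homo λ k → A i k ℚ.* B k j) (RS.sum-cong-≋ λ k → *-homo (A i k) (B k j))

  map-*ᴹ-*ᴹ : ∀ {k l m n} (A : Matrix k l) (B : Matrix l m) (C : Matrix m n) →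
              map (A *ᴹ B *ᴹ C) RP.≋ map A MR.*ᴹ map B MR.*ᴹ map C
  map-*ᴹ-*ᴹ A B C i j = R.trans (map-*ᴹ (A *ᴹ B) C i j)
    (RP.*ᵛ-cong (map-*ᴹ A B) (λ _ → R.refl) i)

  map-δ : ∀ {n} → map (δ {n}) RP.≋ RP.δ
  map-δ i j with does (i Fin.≟ j)
  ... | true  = 1#-homo
  ... | false = 0#-homo

  -- Qᵀ(A + rJ)Q = QᵀAQ + r QᵀJQ, and both conjugates on the right are known: they are `A′` and J.
  orthogonal⇒similar : ∀ {n} {A A′ Q : Matrix n n} r {X X′ : MR.Matrix n n} →
    Q ᵀ *ᴹ Q ≋ δ → Q *ᴹ Q ᵀ ≋ δ → A′ ≋ Q ᵀ *ᴹ A *ᴹ Q → allOnes ≋ Q ᵀ *ᴹ allOnes *ᴹ Q →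
    X RP.≋ map A MR.+ᴹ r MR.·ᴹ map allOnes → X′ RP.≋ map A′ MR.+ᴹ r MR.·ᴹ map allOnes →
    RP.Similar X X′
  orthogonal⇒similar {A = A} {A′} {Q} r {X} {X′} QᵀQ≋δ QQᵀ≋δ A′≋QᵀAQ J≋QᵀJQ X≋ X′≋ =
    RP.conjugate⇒similar
      (λ i j → inverse Q (Q ᵀ) QQᵀ≋δ i j)
      (λ i j → inverse (Q ᵀ) Q QᵀQ≋δ i j)
      (λ i j → begin
          X′ i j
            ≈⟨ X′≋ i j ⟩
          f (A′ i j) R.+ r R.* f 1ℚ
            ≈⟨ R.+-cong (conjugate A A′≋QᵀAQ i j) (R.*-congˡ (conjugate allOnes J≋QᵀJQ i j)) ⟩
          (map (Q ᵀ) MR.*ᴹ map A MR.*ᴹ map Q) i j R.+ r R.* (map (Q ᵀ) MR.*ᴹ map allOnes MR.*ᴹ map Q) i j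
            ≈⟨ RP.conjugate-affine (map (Q ᵀ)) (map A) (map allOnes) r (map Q) i j ⟨
          (map (Q ᵀ) MR.*ᴹ (map A MR.+ᴹ r MR.·ᴹ map allOnes) MR.*ᴹ map Q) i j
            ≈⟨ RP.conjugate-cong (map (Q ᵀ)) (map Q) X≋ i j ⟨
          (map (Q ᵀ) MR.*ᴹ X MR.*ᴹ map Q) i j
            ∎)
    where
    open SetoidReasoning R.setoid

    inverse : ∀ P Q → P *ᴹ Q ≋ δ → map P MR.*ᴹ map Q RP.≋ RP.δ
    inverse P Q PQ≋δ i j = R.trans (R.sym (map-*ᴹ P Q i j)) (R.trans (map-cong PQ≋δ i j) (map-δ i j))

    conjugate : ∀ {A′} A → A′ ≋ Q ᵀ *ᴹ A *ᴹ Q → map A′ RP.≋ map (Q ᵀ) MR.*ᴹ map A MR.*ᴹ map Q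
    conjugate A A′≋QᵀAQ i j = R.trans (map-cong A′≋QᵀAQ i j) (map-*ᴹ-*ᴹ (Q ᵀ) A Q i j)

fromℚ-isRingHomomorphism :
  IsRingHomomorphism ℚ.+-*-rawRing (CommutativeRing.rawRing ℝ-commutativeRing) fromℚ
fromℚ-isRingHomomorphism = record
  { isSemiringHomomorphism = record
    { isNearSemiringHomomorphism = record
      { +-isMonoidHomomorphism = record
        { isMagmaHomomorphism = record
          { isRelHomomorphism = record { cong = λ { refl → ℝ-Ring.refl } }
          ; homo = λ p q → pointwise λ _ → refl
          }
        ; ε-homo = ℝ-Ring.refl
        }
      ; *-homo = λ p q → pointwise λ _ → refl
      }
    ; 1#-homo = ℝ-Ring.refl
    }
  ; -‿homo = λ p → pointwise λ _ → refl
  }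
  where module ℝ-Ring = CommutativeRing ℝ-commutativeRing

open ≡-Reasoning
open import Data.Rational.Base using (_+_; _*_; -_; ∣_∣)
open CommutativeSemigroupProperties (CommutativeRing.*-commutativeSemigroup ℚ.+-*-commutativeRing)
  using (x∙yz≈y∙xz)
open Blocks using (O; J)

-- Extension of a matrix by the identity outside a set of indices.

δ-injective : ∀ {m n} {f : Fin m → Fin n} → Injective _≡_ _≡_ f →
              ∀ i j → δ (f i) (f j) ≡ δ i j
δ-injective {f = f} inj i j with f i Fin.≟ f j | i Fin.≟ j
... | yes _     | yes _   = refl
... | yes fi≡fj | no  i≢j = contradiction (inj fi≡fj) i≢j
... | no  fi≢fj | yes i≡j = contradiction (cong f i≡j) fi≢fj
... | no  _     | no  _   = refl

δ-≢ : ∀ {n} {i j : Fin n} → i ≢ j → δ i j ≡ 0ℚ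
δ-≢ {i = i} {j} i≢j with i Fin.≟ j
... | yes i≡j = contradiction i≡j i≢j
... | no  _   = refl

sum-δʳ : ∀ {n} (v : Vector n) j → ∑[ i < n ] (v i * δ i j) ≡ v j
sum-δʳ v j = trans
  (sum-cong-≗ λ i → trans (ℚ.*-comm (v i) (δ i j)) (cong (_* v i) (δ-sym i j)))
  (sum-δ j v)

module Extension {k m} (vertex : Fin k → Fin m) (injective : Injective _≡_ _≡_ vertex) where

  Outside : Fin m → Set
  Outside x = ∀ p → x ≢ vertex p

  place : ∀ x → (∃[ p ] x ≡ vertex p) ⊎ Outside x
  place x with Fin.any? (λ p → x Fin.≟ vertex p)
  ... | yes x∈C = inj₁ x∈C
  ... | no  x∉C = inj₂ λ p x≡p → x∉C (p , x≡p)

  index : Fin m → Maybe (Fin k)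
  index x with place x
  ... | inj₁ (p , _) = just p
  ... | inj₂ _       = nothing

  index-vertex : ∀ p → index (vertex p) ≡ just p
  index-vertex p with place (vertex p)
  ... | inj₁ (q , p≡q) = cong just (injective (sym p≡q))
  ... | inj₂ out       = contradiction refl (out p)

  index-outside : ∀ {x} → Outside x → index x ≡ nothing
  index-outside {x} out with place x
  ... | inj₁ (p , x≡p) = contradiction x≡p (out p)
  ... | inj₂ _         = refl

  -- Every t x equals the sum over p of `t (vertex p) * δ (vertex p) x`: by injectivity for x in the
  -- image, and because both sides vanish elsewhere. Exchanging the two sums gives the claim.
  sum-image : (t : Vector m) → (∀ {x} → Outside x → t x ≡ 0ℚ) →
              sum t ≡ ∑[ p < k ] t (vertex p)
  sum-image t t≡0 = begin
    sum t                                               ≡⟨ sum-cong-≗ (expand _ ∘ place) ⟩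
    ∑[ x < m ] ∑[ p < k ] (t (vertex p) * δ (vertex p) x)    ≡⟨ ∑-comm {m = m} {n = k} _ ⟩
    ∑[ p < k ] ∑[ x < m ] (t (vertex p) * δ (vertex p) x)    ≡⟨ sum-cong-≗ (λ p → sum-cong-≗ λ x →
                                                                  ℚ.*-comm (t (vertex p)) (δ (vertex p) x)) ⟩
    ∑[ p < k ] ∑[ x < m ] (δ (vertex p) x * t (vertex p))    ≡⟨ sum-cong-≗ (λ p → sum-δ (vertex p) (λ _ → t (vertex p))) ⟩
    ∑[ p < k ] t (vertex p)                             ∎
    where
    expand : ∀ x → (∃[ p ] x ≡ vertex p) ⊎ Outside x →
             t x ≡ ∑[ p < k ] (t (vertex p) * δ (vertex p) x)
    expand x (inj₁ (q , refl)) = sym (trans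
      (sum-cong-≗ λ p → cong (t (vertex p) *_) (δ-injective injective p q))
      (sum-δʳ (t ∘ vertex) q))
    expand x (inj₂ out) = trans (t≡0 out) (sym (sum-zero _ λ p →
      trans (cong (t (vertex p) *_) (δ-≢ (out p ∘ sym))) (ℚ.*-zeroʳ (t (vertex p)))))

  -- For a mixed pair `δ x y` is 0, so this is the direct sum of R and an identity matrix.
  extend : Matrix k k → Matrix m m
  extend R x y with index x | index y
  ... | just p | just q = R p q
  ... | _      | _      = δ x y

  extend-inside : ∀ R p q → extend R (vertex p) (vertex q) ≡ R p q
  extend-inside R p q rewrite index-vertex p | index-vertex q = refl

  extend-outsideˡ : ∀ R {x} y → Outside x → extend R x y ≡ δ x y
  extend-outsideˡ R y out rewrite index-outside out = refl

  extend-ᵀ : ∀ R x y → (extend R ᵀ) x y ≡ extend (R ᵀ) x y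
  extend-ᵀ R x y with index x | index y
  ... | just p  | just q  = refl
  ... | just p  | nothing = δ-sym y x
  ... | nothing | just q  = δ-sym y x
  ... | nothing | nothing = δ-sym y x

  extend-outsideʳ : ∀ R x {y} → Outside y → extend R x y ≡ δ x y
  extend-outsideʳ R x {y} out = begin
    extend R x y      ≡⟨ extend-ᵀ (R ᵀ) x y ⟨
    extend (R ᵀ) y x  ≡⟨ extend-outsideˡ (R ᵀ) x out ⟩
    δ y x             ≡⟨ δ-sym y x ⟩
    δ x y             ∎

  -- The column of `extend R` at y is a unit vector.
  sum-extend-outside : ∀ R (f : Vector m) {y} → Outside y →
    ∑[ x < m ] (f x * extend R x y) ≡ f y
  sum-extend-outside R f {y} out = trans
    (sum-cong-≗ λ x → cong (f x *_) (extend-outsideʳ R x out))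
    (sum-δʳ f y)

  -- The column at `vertex q` vanishes outside the image of `vertex`, so `sum-image` applies.
  sum-extend-inside : ∀ R (f : Vector m) q →
    ∑[ x < m ] (f x * extend R x (vertex q)) ≡ ∑[ p < k ] (f (vertex p) * R p q)
  sum-extend-inside R f q = trans
    (sum-image _ λ {x} out → trans
      (cong (f x *_) (trans (extend-outsideˡ R (vertex q) out) (δ-≢ (out q))))
      (ℚ.*-zeroʳ (f x)))
    (sum-cong-≗ λ p → cong (f (vertex p) *_) (extend-inside R p q))

  extend-orthogonal : ∀ R → R ᵀ *ᴹ R ≋ δ → extend R ᵀ *ᴹ extend R ≋ δ
  extend-orthogonal R RᵀR≋δ x y = go (place x) (place y)
    where
    go : ∀ {x y} → (∃[ p ] x ≡ vertex p) ⊎ Outside x → (∃[ q ] y ≡ vertex q) ⊎ Outside y →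
         (extend R ᵀ *ᴹ extend R) x y ≡ δ x y
    go {x} {y} _ (inj₂ out) = begin
      (extend R ᵀ *ᴹ extend R) x y  ≡⟨ sum-extend-outside R (λ z → extend R z x) out ⟩
      extend R y x                  ≡⟨ extend-outsideˡ R x out ⟩
      δ y x                         ≡⟨ δ-sym y x ⟩
      δ x y                         ∎
    go (inj₁ (p , refl)) (inj₁ (q , refl)) = begin
      (extend R ᵀ *ᴹ extend R) (vertex p) (vertex q)
        ≡⟨ sum-extend-inside R (λ z → extend R z (vertex p)) q ⟩
      ∑[ s < k ] (extend R (vertex s) (vertex p) * R s q)
        ≡⟨ sum-cong-≗ (λ s → cong (_* R s q) (extend-inside R s p)) ⟩
      (R ᵀ *ᴹ R) p q
        ≡⟨ RᵀR≋δ p q ⟩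
      δ p q
        ≡⟨ δ-injective injective p q ⟨
      δ (vertex p) (vertex q)
        ∎
    go {x} (inj₂ out) (inj₁ (q , refl)) = begin
      (extend R ᵀ *ᴹ extend R) x (vertex q)
        ≡⟨ sum-extend-inside R (λ z → extend R z x) q ⟩
      ∑[ p < k ] (extend R (vertex p) x * R p q)
        ≡⟨ sum-zero _ (λ p → trans
             (cong (_* R p q) (trans (extend-outsideʳ R (vertex p) out) (δ-≢ (out p ∘ sym))))
             (ℚ.*-zeroˡ (R p q))) ⟩
      0ℚ
        ≡⟨ δ-≢ (out q) ⟨
      δ x (vertex q)
        ∎

  -- This is `extend-orthogonal` for `R ᵀ`, whose extension is the transpose of `extend R`.
  extend-orthogonalʳ : ∀ R → R *ᴹ R ᵀ ≋ δ → extend R *ᴹ extend R ᵀ ≋ δ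
  extend-orthogonalʳ R RRᵀ≋δ x y = trans
    (sum-cong-≗ λ z → cong₂ _*_ (sym (extend-ᵀ (R ᵀ) x z)) (extend-ᵀ R z y))
    (extend-orthogonal (R ᵀ) RRᵀ≋δ x y)

  -- The four blocks of the equation `A′` = QᵀAQ for Q = `extend R`; each factor Q acts trivially on
  -- the outside indices.
  record Conjugates (R : Matrix k k) (A A′ : Matrix m m) : Set where
    field
      corner  : ∀ {x y} → Outside x → Outside y → A′ x y ≡ A x y
      columns : ∀ {x} q → Outside x →
                A′ x (vertex q) ≡ ∑[ p < k ] (A x (vertex p) * R p q)
      rows    : ∀ {y} p → Outside y →
                A′ (vertex p) y ≡ ∑[ s < k ] (A (vertex s) y * R s p)
      core    : ∀ p q → A′ (vertex p) (vertex q) ≡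
                (R ᵀ *ᴹ (λ s t → A (vertex s) (vertex t)) *ᴹ R) p q

  extend-conjugates : ∀ {R A A′} → Conjugates R A A′ →
                      A′ ≋ extend R ᵀ *ᴹ A *ᴹ extend R
  extend-conjugates {R} {A} {A′} h x y = sym (go (place x) (place y))
    where
    open Conjugates h
    Q = extend R

    left-outside : ∀ {x} y → Outside x → (Q ᵀ *ᴹ A) x y ≡ A x y
    left-outside {x} y out = trans
      (sum-cong-≗ λ z → ℚ.*-comm (Q z x) (A z y))
      (sum-extend-outside R (λ z → A z y) out)

    left-inside : ∀ p y → (Q ᵀ *ᴹ A) (vertex p) y ≡ ∑[ s < k ] (A (vertex s) y * R s p)
    left-inside p y = trans
      (sum-cong-≗ λ z → ℚ.*-comm (Q z (vertex p)) (A z y))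
      (sum-extend-inside R (λ z → A z y) p)

    go : ∀ {x y} → (∃[ p ] x ≡ vertex p) ⊎ Outside x → (∃[ q ] y ≡ vertex q) ⊎ Outside y →
         (Q ᵀ *ᴹ A *ᴹ Q) x y ≡ A′ x y
    go {x} {y} (inj₂ outˣ) (inj₂ outʸ) = begin
      (Q ᵀ *ᴹ A *ᴹ Q) x y  ≡⟨ sum-extend-outside R ((Q ᵀ *ᴹ A) x) outʸ ⟩
      (Q ᵀ *ᴹ A) x y       ≡⟨ left-outside y outˣ ⟩
      A x y                ≡⟨ corner outˣ outʸ ⟨
      A′ x y               ∎
    go {x} {y} (inj₁ (p , refl)) (inj₂ outʸ) = begin
      (Q ᵀ *ᴹ A *ᴹ Q) x y                   ≡⟨ sum-extend-outside R ((Q ᵀ *ᴹ A) x) outʸ ⟩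
      (Q ᵀ *ᴹ A) x y                        ≡⟨ left-inside p y ⟩
      ∑[ s < k ] (A (vertex s) y * R s p)   ≡⟨ rows p outʸ ⟨
      A′ x y                                ∎
    go {x} {y} (inj₂ outˣ) (inj₁ (q , refl)) = begin
      (Q ᵀ *ᴹ A *ᴹ Q) x y                              ≡⟨ sum-extend-inside R ((Q ᵀ *ᴹ A) x) q ⟩
      ∑[ p < k ] ((Q ᵀ *ᴹ A) x (vertex p) * R p q)     ≡⟨ sum-cong-≗ (λ p → cong (_* R p q) (left-outside (vertex p) outˣ)) ⟩
      ∑[ p < k ] (A x (vertex p) * R p q)              ≡⟨ columns q outˣ ⟨
      A′ x y                                           ∎
    go {x} {y} (inj₁ (p , refl)) (inj₁ (q , refl)) = begin
      (Q ᵀ *ᴹ A *ᴹ Q) x y                              ≡⟨ sum-extend-inside R ((Q ᵀ *ᴹ A) x) q ⟩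
      ∑[ t < k ] ((Q ᵀ *ᴹ A) x (vertex t) * R t q)     ≡⟨ sum-cong-≗ (λ t → cong (_* R t q) (trans (left-inside p (vertex t))
                                                            (sum-cong-≗ λ s → ℚ.*-comm (A (vertex s) (vertex t)) (R s p)))) ⟩
      (R ᵀ *ᴹ (λ s t → A (vertex s) (vertex t)) *ᴹ R) p q  ≡⟨ core p q ⟨
      A′ x y                                           ∎

-- The matrix `R₁₂` and the characters of its blocks.

_≋?_ : ∀ {m n} (A B : Matrix m n) → Dec (A ≋ B)
A ≋? B = Fin.all? λ i → Fin.all? λ j → A i j ℚ.≟ B i j

-- Reversing 0, ..., 5 turns the cyclic predecessor into the cyclic successor.
next : Fin 6 → Fin 6
next i = opposite (pred₆ (opposite i))

pred-next : ∀ i → pred₆ (next i) ≡ i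
pred-next = toWitness {a? = Fin.all? λ i → pred₆ (next i) Fin.≟ i} _

next-pred : ∀ i → next (pred₆ i) ≡ i
next-pred = toWitness {a? = Fin.all? λ i → next (pred₆ i) Fin.≟ i} _

-- Column block j of `R₁₂` has ½J in row block j and ½Y in row block j + 1. The index 0 or 1 selects
-- one of the two, and with it the character.
shift : Fin 2 → Fin 6 → Fin 6
shift zero       i = i
shift (suc zero) i = next i

-- The characters (1,1) and (1,-1), so that J = χ₀χ₀ᵀ and Y = χ₁χ₁ᵀ.
χ : Matrix 2 2
χ (suc zero) (suc zero) = - 1ℚ
χ _          _          = 1ℚ

fromBlocks-combine : ∀ X i j a b → fromBlocks X (combine i a) (combine j b) ≡ X i j a b
fromBlocks-combine X i j a b = cong₂
  (λ (i , a) (j , b) → X i j a b)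
  (Fin.remQuot-combine i a) (Fin.remQuot-combine j b)

-- Block (i, j) is ½ χ₀χ₀ᵀ for i = j, ½ χ₁χ₁ᵀ for i = j + 1, and zero otherwise; verified by
-- evaluating all entries.
R₁₂-combine : ∀ i a j b → R₁₂ (combine i a) (combine j b) ≡
              ∑[ β < 2 ] (δ (shift β j) i * (½ * χ β a * χ β b))
R₁₂-combine = toWitness {a? = Fin.all? λ i → Fin.all? λ a → Fin.all? λ j → Fin.all? λ b → _ ℚ.≟ _} _

-- The factor `δ` of `R₁₂-combine` leaves only the blocks j and j + 1 of the six.
sum-R₁₂ : ∀ (u : Vector 12) j b →
  ∑[ k < 12 ] (u k * R₁₂ k (combine j b)) ≡
  ∑[ β < 2 ] ∑[ a < 2 ] (u (combine (shift β j) a) * (½ * χ β a * χ β b))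
sum-R₁₂ u j b = begin
  ∑[ k < 12 ] (u k * R₁₂ k (combine j b))
    ≡⟨ sum-combine 6 2 (λ k → u k * R₁₂ k (combine j b)) ⟩
  ∑[ i < 6 ] ∑[ a < 2 ] (u (combine i a) * R₁₂ (combine i a) (combine j b))
    ≡⟨ sum-cong-≗ (λ i → trans (sum-cong-≗ λ a → entry i a) (∑-comm (λ a β → δ (shift β j) i * term β i a))) ⟩
  ∑[ i < 6 ] ∑[ β < 2 ] ∑[ a < 2 ] (δ (shift β j) i * term β i a)
    ≡⟨ ∑-comm (λ i β → ∑[ a < 2 ] (δ (shift β j) i * term β i a)) ⟩
  ∑[ β < 2 ] ∑[ i < 6 ] ∑[ a < 2 ] (δ (shift β j) i * term β i a)
    ≡⟨ sum-cong-≗ (λ β → trans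
         (sum-cong-≗ λ i → sym (*-distribˡ-sum (δ (shift β j) i) (term β i)))
         (sum-δ (shift β j) (λ i → sum (term β i)))) ⟩
  ∑[ β < 2 ] ∑[ a < 2 ] term β (shift β j) a
    ∎
  where
  term : Fin 2 → Fin 6 → Fin 2 → ℚ
  term β i a = u (combine i a) * (½ * χ β a * χ β b)

  entry : ∀ i a → u (combine i a) * R₁₂ (combine i a) (combine j b) ≡
                  ∑[ β < 2 ] (δ (shift β j) i * term β i a)
  entry i a = begin
    u (combine i a) * R₁₂ (combine i a) (combine j b)
      ≡⟨ cong (u (combine i a) *_) (R₁₂-combine i a j b) ⟩
    u (combine i a) * ∑[ β < 2 ] (δ (shift β j) i * (½ * χ β a * χ β b))
      ≡⟨ *-distribˡ-sum (u (combine i a)) (λ β → δ (shift β j) i * (½ * χ β a * χ β b)) ⟩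
    ∑[ β < 2 ] (u (combine i a) * (δ (shift β j) i * (½ * χ β a * χ β b)))
      ≡⟨ sum-cong-≗ (λ β → x∙yz≈y∙xz (u (combine i a)) (δ (shift β j) i) (½ * χ β a * χ β b)) ⟩
    ∑[ β < 2 ] (δ (shift β j) i * term β i a)
      ∎

R₁₂ᵀR₁₂≋δ : R₁₂ ᵀ *ᴹ R₁₂ ≋ δ
R₁₂ᵀR₁₂≋δ = toWitness {a? = (R₁₂ ᵀ *ᴹ R₁₂) ≋? δ} _

R₁₂R₁₂ᵀ≋δ : R₁₂ *ᴹ R₁₂ ᵀ ≋ δ
R₁₂R₁₂ᵀ≋δ = toWitness {a? = (R₁₂ *ᴹ R₁₂ ᵀ) ≋? δ} _

-- The factor `1ℚ` is an entry of `allOnes`, so the sum has the form of an entry of a product of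
-- `allOnes` with `R₁₂`.
R₁₂-columnSum : ∀ q → ∑[ p < 12 ] (1ℚ * R₁₂ p q) ≡ 1ℚ
R₁₂-columnSum = toWitness {a? = Fin.all? λ q → ∑[ p < 12 ] (1ℚ * R₁₂ p q) ℚ.≟ 1ℚ} _

-- Character coefficients of blocks under conjugation by `R₁₂`.

-- X - ½J = ½ Σ tₐᵦ χₐχᵦᵀ, where t = coefficients X.
coefficients : Block → Block
coefficients X = ½ ·ᴹ (χ *ᴹ (X -ᴹ ½ ·ᴹ allOnes) *ᴹ χ)

-- The coefficients of block (i, j) after conjugation: column block j of `R₁₂` picks the χ₀ part
-- from block j and the χ₁ part from block j + 1, and likewise for rows.
mix : (Fin 6 → Fin 6 → Block) → Fin 6 → Fin 6 → Block
mix X i j α β = coefficients (X (shift α i) (shift β j)) α β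

blockAt : Matrix 12 12 → Fin 6 → Fin 6 → Block
blockAt M i j a b = M (combine i a) (combine j b)

module _ where
  open +-*-Solver

  private
    -- The final zero mirrors the unfolding of `sum` over `Fin 2`, so that the polynomials evaluate
    -- definitionally to the stated expressions.
    ∑ᴾ : ∀ {n} → (Fin 2 → Polynomial n) → Polynomial n
    ∑ᴾ f = f zero :+ (f (suc zero) :+ con 0ℚ)

    coefficientᴾ : ∀ {n} → Fin 2 → Fin 2 → (Fin 2 → Fin 2 → Polynomial n) → Polynomial n
    coefficientᴾ α β X =
      con ½ :* ∑ᴾ λ d → ∑ᴾ (λ c → con (χ α c) :* (X c d :+ :- (con ½ :* con 1ℚ))) :* con (χ d β)

  -- (J - X) - ½J = -(X - ½J), and the coefficients are linear in X - ½J.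
  coefficients-complement : ∀ X α β → coefficients (J -ᴹ X) α β ≡ - coefficients X α β
  coefficients-complement X = λ where
      -- For concrete indices the entries of `χ` are numerals, and the solver can compare normal
      -- forms.
      zero       zero       → prove ρ (lhs zero zero) (rhs zero zero) refl
      zero       (suc zero) → prove ρ (lhs zero (suc zero)) (rhs zero (suc zero)) refl
      (suc zero) zero       → prove ρ (lhs (suc zero) zero) (rhs (suc zero) zero) refl
      (suc zero) (suc zero) → prove ρ (lhs (suc zero) (suc zero)) (rhs (suc zero) (suc zero)) refl
    where
    ρ = Vec.tabulate (uncurry X ∘ remQuot 2)
    x = λ c d → var (combine c d)
    lhs = λ α β → coefficientᴾ α β (λ c d → con 1ℚ :+ :- x c d)
    rhs = λ α β → :- coefficientᴾ α β x

  -- Applying `sum-R₁₂` on both sides leaves the four blocks at `shift α i`, `shift β j`; the rest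
  -- is a polynomial identity in their 16 entries.
  R₁₂-mix : ∀ M i a j b → (R₁₂ ᵀ *ᴹ M *ᴹ R₁₂) (combine i a) (combine j b) ≡
            ½ + ½ * (χ *ᴹ mix (blockAt M) i j *ᴹ χ) a b
  R₁₂-mix M i a j b = begin
    (R₁₂ ᵀ *ᴹ M *ᴹ R₁₂) p q
      ≡⟨ sum-R₁₂ ((R₁₂ ᵀ *ᴹ M) p) j b ⟩
    ∑[ β < 2 ] ∑[ d < 2 ] ((R₁₂ ᵀ *ᴹ M) p (combine (shift β j) d) * (½ * χ β d * χ β b))
      ≡⟨ sum-cong-≗ (λ β → sum-cong-≗ λ d → cong (_* (½ * χ β d * χ β b)) (left (combine (shift β j) d))) ⟩
    ∑[ β < 2 ] ∑[ d < 2 ] (∑[ α < 2 ] ∑[ c < 2 ] (Y α c β d * (½ * χ α c * χ α a)) * (½ * χ β d * χ β b))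
      ≡⟨ polynomial a b ⟩
    ½ + ½ * (χ *ᴹ mix (blockAt M) i j *ᴹ χ) a b
      ∎
    where
    p = combine i a
    q = combine j b
    Y = λ α c β d → M (combine (shift α i) c) (combine (shift β j) d)

    left : ∀ k → (R₁₂ ᵀ *ᴹ M) p k ≡
           ∑[ α < 2 ] ∑[ c < 2 ] (M (combine (shift α i) c) k * (½ * χ α c * χ α a))
    left k = trans (sum-cong-≗ λ l → ℚ.*-comm (R₁₂ l p) (M l k)) (sum-R₁₂ (λ l → M l k) i a)

    ρ : Vec.Vec ℚ 16
    ρ = Vec.tabulate λ k → let αc , βd = remQuot {4} 4 k in
          uncurry (uncurry Y (remQuot {2} 2 αc)) (remQuot {2} 2 βd)
    y : Fin 2 → Fin 2 → Fin 2 → Fin 2 → Polynomial 16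
    y α c β d = var (combine (combine α c) (combine β d))

    lhs = λ a b → ∑ᴾ λ β → ∑ᴾ λ d →
      ∑ᴾ (λ α → ∑ᴾ λ c → y α c β d :* con (½ * χ α c * χ α a)) :* con (½ * χ β d * χ β b)
    rhs = λ a b → con ½ :+ con ½ :* ∑ᴾ λ β →
      ∑ᴾ (λ α → con (χ a α) :* coefficientᴾ α β λ c d → y α c β d) :* con (χ β b)

    polynomial : ∀ a b →
      ∑[ β < 2 ] ∑[ d < 2 ] (∑[ α < 2 ] ∑[ c < 2 ] (Y α c β d * (½ * χ α c * χ α a)) * (½ * χ β d * χ β b)) ≡
      ½ + ½ * (χ *ᴹ mix (blockAt M) i j *ᴹ χ) a b
    polynomial zero       zero       = prove ρ (lhs zero zero) (rhs zero zero) refl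
    polynomial zero       (suc zero) = prove ρ (lhs zero (suc zero)) (rhs zero (suc zero)) refl
    polynomial (suc zero) zero       = prove ρ (lhs (suc zero) zero) (rhs (suc zero) zero) refl
    polynomial (suc zero) (suc zero) = prove ρ (lhs (suc zero) (suc zero)) (rhs (suc zero) (suc zero)) refl

-- Complementation and signed matrix units.

-1ℚ : ℚ
-1ℚ = - 1ℚ

infix 4 _≋±_

-- The sign is that of X - ½J, which complementation reverses.
_≋±_ : Block → Block → Set
X ≋± X₀ = X ≋ X₀ ⊎ X ≋ J -ᴹ X₀

lookup-zipWith : ∀ {A B C : Set} (f : A → B → C) n as bs (j : Fin (suc n)) →
  Row.lookup (Row.zipWith f (suc n) as bs) j ≡ f (Row.lookup as j) (Row.lookup bs j)
lookup-zipWith f zero    a        b        zero    = refl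
lookup-zipWith f (suc n) (a , as) (b , bs) zero    = refl
lookup-zipWith f (suc n) (a , as) (b , bs) (suc j) = lookup-zipWith f n as bs j

-- Diagonal blocks stay `O`; below the diagonal, complementation commutes with transposition because
-- J is symmetric.
symmetricBlocks-complement : ∀ {m} (c : Triangle Bool m) t i j →
  symmetricBlocks (complementWhere c t) i j ≋± symmetricBlocks t i j
symmetricBlocks-complement end end zero zero = inj₁ λ _ _ → refl
symmetricBlocks-complement (c ⨾ s) (r ⨾ t) zero zero = inj₁ λ _ _ → refl
symmetricBlocks-complement (c ⨾ s) (r ⨾ t) zero (suc j)
  rewrite lookup-zipWith (λ c B → if c then J -ᴹ B else B) _ c r j with Row.lookup c j
... | true  = inj₂ λ _ _ → refl
... | false = inj₁ λ _ _ → refl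
symmetricBlocks-complement (c ⨾ s) (r ⨾ t) (suc i) zero
  rewrite lookup-zipWith (λ c B → if c then J -ᴹ B else B) _ c r i with Row.lookup c i
... | true  = inj₂ λ _ _ → refl
... | false = inj₁ λ _ _ → refl
symmetricBlocks-complement (c ⨾ s) (r ⨾ t) (suc i) (suc j) = symmetricBlocks-complement s t i j

symmetricBlocks-diagonal : ∀ {m} (t : Triangle Block m) i → symmetricBlocks t i i ≡ O
symmetricBlocks-diagonal end     zero    = refl
symmetricBlocks-diagonal (r ⨾ t) zero    = refl
symmetricBlocks-diagonal (r ⨾ t) (suc i) = symmetricBlocks-diagonal t i

coefficients-cong : ∀ {X X′} → X ≋ X′ → coefficients X ≋ coefficients X′
coefficients-cong X≋X′ α β = cong (½ *_)
  (conjugate-cong χ χ (λ c d → cong (_+ - (½ * 1ℚ)) (X≋X′ c d)) α β)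

-- Absolute values do not see complementation, so a check on the 18 listed matrices covers every
-- choice of complemented blocks.
∣coefficients∣-cong : ∀ {X X₀} → X ≋± X₀ → ∀ α β → ∣ coefficients X α β ∣ ≡ ∣ coefficients X₀ α β ∣
∣coefficients∣-cong (inj₁ X≋X₀) α β = cong ∣_∣ (coefficients-cong X≋X₀ α β)
∣coefficients∣-cong {X₀ = X₀} (inj₂ X≋J-X₀) α β = trans
  (cong ∣_∣ (trans (coefficients-cong X≋J-X₀ α β) (coefficients-complement X₀ α β)))
  (ℚ.∣-p∣≡∣p∣ _)

unit : Fin 2 → Fin 2 → Block
unit α β α′ β′ = δ α α′ * δ β β′

-- Plus or minus a matrix unit. The absolute values make the property insensitive to complementing
-- each of the four contributing blocks independently.
SignedUnit : Block → Set
SignedUnit t = ∃[ α ] ∃[ β ] ∀ α′ β′ → ∣ t α′ β′ ∣ ≡ unit α β α′ β′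

signedUnit? : ∀ t → Dec (SignedUnit t)
signedUnit? t = Fin.any? λ α → Fin.any? λ β → Fin.all? λ α′ → Fin.all? λ β′ →
  ∣ t α′ β′ ∣ ℚ.≟ unit α β α′ β′

-- The only property of the 18 matrices used; decided by evaluation.
blocks-signedUnit : ∀ k i j → SignedUnit (mix (symmetricBlocks (Vec.lookup blocks k)) i j)
blocks-signedUnit = toWitness
  {a? = Fin.all? λ k → Fin.all? λ i → Fin.all? λ j →
        signedUnit? (mix (symmetricBlocks (Vec.lookup blocks k)) i j)} _

∣p∣≡1⇒p≡±1 : ∀ p → ∣ p ∣ ≡ 1ℚ → p ≡ 1ℚ ⊎ p ≡ -1ℚ
∣p∣≡1⇒p≡±1 p ∣p∣≡1 with ℚ.∣p∣≡p∨∣p∣≡-p p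
... | inj₁ ∣p∣≡p  = inj₁ (trans (sym ∣p∣≡p) ∣p∣≡1)
... | inj₂ ∣p∣≡-p = inj₂ (ℚ.neg-injective (trans (sym ∣p∣≡-p) ∣p∣≡1))

module _ (t : Block) α β (∣t∣≋unit : ∀ α′ β′ → ∣ t α′ β′ ∣ ≡ unit α β α′ β′) where

  signedUnit-sign : t α β ≡ 1ℚ ⊎ t α β ≡ -1ℚ
  signedUnit-sign = ∣p∣≡1⇒p≡±1 (t α β)
    (trans (∣t∣≋unit α β) (cong₂ _*_ (δ-refl α) (δ-refl β)))

  signedUnit≋ : t ≋ t α β ·ᴹ unit α β
  signedUnit≋ α′ β′ with α Fin.≟ α′ | β Fin.≟ β′ | ∣t∣≋unit α′ β′
  ... | yes refl | yes refl | _     = sym (ℚ.*-identityʳ (t α β))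
  ... | yes _    | no _     | ∣t∣≡0 = trans (ℚ.∣p∣≡0⇒p≡0 _ ∣t∣≡0) (sym (ℚ.*-zeroʳ (t α β)))
  ... | no _     | yes _    | ∣t∣≡0 = trans (ℚ.∣p∣≡0⇒p≡0 _ ∣t∣≡0) (sym (ℚ.*-zeroʳ (t α β)))
  ... | no _     | no _     | ∣t∣≡0 = trans (ℚ.∣p∣≡0⇒p≡0 _ ∣t∣≡0) (sym (ℚ.*-zeroʳ (t α β)))

-- The conjugated matrix as an adjacency matrix.

Binary : ℚ → Set
Binary q = q ≡ 0ℚ ⊎ q ≡ 1ℚ

binary? : ∀ q → Dec (Binary q)
binary? q = (q ℚ.≟ 0ℚ) ⊎-dec (q ℚ.≟ 1ℚ)

-- The product has entries s `χ a α` `χ β b` = ±1, so the value is ½ ± ½.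
±unit-binary : ∀ {s} → s ≡ 1ℚ ⊎ s ≡ -1ℚ → ∀ α β a b →
               Binary (½ + ½ * (χ *ᴹ (s ·ᴹ unit α β) *ᴹ χ) a b)
±unit-binary (inj₁ refl) = toWitness {a? = Fin.all? λ α → Fin.all? λ β → Fin.all? λ a → Fin.all? λ b →
  binary? (½ + ½ * (χ *ᴹ (1ℚ ·ᴹ unit α β) *ᴹ χ) a b)} _
±unit-binary (inj₂ refl) = toWitness {a? = Fin.all? λ α → Fin.all? λ β → Fin.all? λ a → Fin.all? λ b →
  binary? (½ + ½ * (χ *ᴹ (-1ℚ ·ᴹ unit α β) *ᴹ χ) a b)} _

signedUnit-binary : ∀ t → SignedUnit t → ∀ a b → Binary (½ + ½ * (χ *ᴹ t *ᴹ χ) a b)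
signedUnit-binary t (α , β , ∣t∣≋unit) a b = subst (λ q → Binary (½ + ½ * q))
  (sym (conjugate-cong χ χ (signedUnit≋ t α β ∣t∣≋unit) a b))
  (±unit-binary (signedUnit-sign t α β ∣t∣≋unit) α β a b)

-- A nonzero entry at (0, 0) forces t to be minus the matrix unit there, and then χtχ = -J.
signedUnit-diagonal : ∀ t → SignedUnit t → t zero zero ≡ -1ℚ →
                      ∀ a → ½ + ½ * (χ *ᴹ t *ᴹ χ) a a ≡ 0ℚ
signedUnit-diagonal t (α , β , ∣t∣≋unit) t₀₀≡-1 a =
  go α β ∣t∣≋unit (trans (sym (cong ∣_∣ t₀₀≡-1)) (∣t∣≋unit zero zero))
  where
  diagonal : ∀ a → ½ + ½ * (χ *ᴹ (-1ℚ ·ᴹ unit zero zero) *ᴹ χ) a a ≡ 0ℚ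
  diagonal zero       = refl
  diagonal (suc zero) = refl

  go : ∀ α β → (∀ α′ β′ → ∣ t α′ β′ ∣ ≡ unit α β α′ β′) → 1ℚ ≡ unit α β zero zero →
       ½ + ½ * (χ *ᴹ t *ᴹ χ) a a ≡ 0ℚ
  go zero zero h _ = trans
    (cong (λ q → ½ + ½ * q) (conjugate-cong χ χ
      (λ α′ β′ → trans (signedUnit≋ t zero zero h α′ β′) (cong (_* unit zero zero α′ β′) t₀₀≡-1)) a a))
    (diagonal a)
  go zero       (suc zero) _ ()
  go (suc zero) zero       _ ()
  go (suc zero) (suc zero) _ ()

-- After reassociation to Rᵀ(MR), symmetry of M makes the (p, q) entry agree term by term with the
-- (q, p) entry of (RᵀM)R.
conjugate-symmetric : ∀ {m n} (R : Matrix m n) {M : Matrix m m} →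
  (∀ i j → M i j ≡ M j i) → ∀ p q → (R ᵀ *ᴹ M *ᴹ R) p q ≡ (R ᵀ *ᴹ M *ᴹ R) q p
conjugate-symmetric R {M} M-symmetric p q = begin
  (R ᵀ *ᴹ M *ᴹ R) p q
    ≡⟨ *ᵛ-assoc (R ᵀ) M (λ k → R k q) p ⟩
  sum (λ l → R l p * sum (λ k → M l k * R k q))
    ≡⟨ sum-cong-≗ (λ l → trans (ℚ.*-comm (R l p) _) (cong (_* R l p) (sum-cong-≗ λ k →
         trans (ℚ.*-comm (M l k) (R k q)) (cong (R k q *_) (M-symmetric l k))))) ⟩
  (R ᵀ *ᴹ M *ᴹ R) q p
    ∎

combine-all : (P : Fin 12 → Set) → (∀ (i : Fin 6) (a : Fin 2) → P (combine i a)) → ∀ p → P p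
combine-all P h p = subst P (Fin.combine-remQuot {6} 2 p) (h (quotient 2 p) (remainder {6} 2 p))

module _ (M : Matrix 12 12) k c (M≋B : M ≋ B k c) where

  private
    T = symmetricBlocks (complementWhere c (Vec.lookup blocks k))

    S = R₁₂ ᵀ *ᴹ M *ᴹ R₁₂

    blockAt≋ : ∀ i j → blockAt M i j ≋ T i j
    blockAt≋ i j a b = trans (M≋B (combine i a) (combine j b)) (fromBlocks-combine T i j a b)

    mix-signedUnit : ∀ i j → SignedUnit (mix (blockAt M) i j)
    mix-signedUnit i j = let α , β , ∣t∣≋unit = blocks-signedUnit k i j in
      α , β , λ α′ β′ → begin
        ∣ mix (blockAt M) i j α′ β′ ∣
          ≡⟨ cong ∣_∣ (coefficients-cong (blockAt≋ (shift α′ i) (shift β′ j)) α′ β′) ⟩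
        ∣ mix T i j α′ β′ ∣
          ≡⟨ ∣coefficients∣-cong (symmetricBlocks-complement c (Vec.lookup blocks k) (shift α′ i) (shift β′ j)) α′ β′ ⟩
        ∣ mix (symmetricBlocks (Vec.lookup blocks k)) i j α′ β′ ∣
          ≡⟨ ∣t∣≋unit α′ β′ ⟩
        unit α β α′ β′
          ∎

  R₁₂-conjugate-binary : ∀ p q → Binary ((R₁₂ ᵀ *ᴹ M *ᴹ R₁₂) p q)
  R₁₂-conjugate-binary = combine-all (λ p → ∀ q → Binary (S p q)) λ i a →
    combine-all (λ q → Binary (S (combine i a) q)) λ j b →
      subst Binary (sym (R₁₂-mix M i a j b))
        (signedUnit-binary (mix (blockAt M) i j) (mix-signedUnit i j) a b)

  R₁₂-conjugate-diagonal : ∀ p → (R₁₂ ᵀ *ᴹ M *ᴹ R₁₂) p p ≡ 0ℚ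
  R₁₂-conjugate-diagonal = combine-all (λ p → S p p ≡ 0ℚ) λ i a → trans
    (R₁₂-mix M i a i a)
    (signedUnit-diagonal (mix (blockAt M) i i) (mix-signedUnit i i)
      -- As `shift zero` is the identity, this coefficient comes from the diagonal block (i, i),
      -- which is `O`; that of `O` evaluates to -1.
      (trans (coefficients-cong (blockAt≋ i i) zero zero)
             (cong (λ X → coefficients X zero zero)
               (symmetricBlocks-diagonal (complementWhere c (Vec.lookup blocks k)) i)))
      a)

-- Rows indexed by D.

bit : Bool → ℚ
bit b = if b then 1ℚ else 0ℚ

bit-≟ : ∀ {q} → Binary q → bit (does (q ℚ.≟ 1ℚ)) ≡ q
bit-≟ (inj₁ refl) = refl
bit-≟ (inj₂ refl) = refl

degree : (Fin 2 → Bool) → ℕ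
degree f = Subset.∣ Vec.tabulate f ∣

-- A degree is at most 2, so 1 is the only odd value.
degree-odd : ∀ {f g} → degree f ≡ 1 → degree f % 2 ≡ degree g % 2 → degree g ≡ 1
degree-odd {f} {g} f≡1 f≡g with degree f | f≡1 | g zero | g (suc zero)
... | _ | refl | false | true  = refl
... | _ | refl | true  | false = refl
degree-odd f≡1 () | _ | refl | false | false
degree-odd f≡1 () | _ | refl | true  | true

degree≢1⇒≡ : ∀ {f} → degree f ≢ 1 → f (suc zero) ≡ f zero
degree≢1⇒≡ {f} f≢1 with f zero | f (suc zero)
... | false | false = refl
... | true  | true  = refl
... | false | true  = contradiction refl f≢1
... | true  | false = contradiction refl f≢1

-- This is ½(x·e)e + ½(y·f)f for x = `f zero`, the part in C_i, and y = `f (suc zero)`, the part in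
-- C_{i+1}; here e and f are the characters (1,1) and (1,-1).
R₁₂-row : (Fin 2 → Fin 2 → Bool) → Fin 2 → ℚ
R₁₂-row f b = ∑[ β < 2 ] ∑[ a < 2 ] (bit (f β a) * (½ * χ β a * χ β b))

-- Here x·e = 1 and y·f = ±1, the sign telling which entry of y is 1; so ½e ± ½f = y.
R₁₂-row-odd : ∀ f → (∀ β → degree (f β) ≡ 1) → ∀ b → bit (f (suc zero) b) ≡ R₁₂-row f b
R₁₂-row-odd f f≡1 zero
  with f zero zero | f zero (suc zero) | f (suc zero) zero | f (suc zero) (suc zero) | f≡1 zero | f≡1 (suc zero)
... | false | true  | false | true  | refl | refl = refl
... | false | true  | true  | false | refl | refl = refl
... | true  | false | false | true  | refl | refl = refl
... | true  | false | true  | false | refl | refl = refl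
R₁₂-row-odd f f≡1 (suc zero)
  with f zero zero | f zero (suc zero) | f (suc zero) zero | f (suc zero) (suc zero) | f≡1 zero | f≡1 (suc zero)
... | false | true  | false | true  | refl | refl = refl
... | false | true  | true  | false | refl | refl = refl
... | true  | false | false | true  | refl | refl = refl
... | true  | false | true  | false | refl | refl = refl

-- Both parts are constant, so y·f = 0 and ½(x·e)e = x.
R₁₂-row-even : ∀ f → (∀ β → f β (suc zero) ≡ f β zero) → ∀ b → bit (f zero b) ≡ R₁₂-row f b
R₁₂-row-even f f₁≡f₀ zero rewrite f₁≡f₀ zero | f₁≡f₀ (suc zero) with f zero zero | f (suc zero) zero
... | false | false = refl
... | false | true  = refl
... | true  | false = refl
... | true  | true  = refl
R₁₂-row-even f f₁≡f₀ (suc zero) rewrite f₁≡f₀ zero | f₁≡f₀ (suc zero) with f zero zero | f (suc zero) zero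
... | false | false = refl
... | false | true  = refl
... | true  | false = refl
... | true  | true  = refl

-- Construction of the switched graph.

module _ {m} (Γ : Graph m) (v : Fin 6 → Fin 2 → Fin m)
  (v-injective : Injective _≡_ _≡_ (uncurry v)) where

  open Switching Γ v

  vertex-combine : ∀ i a → vertex (combine i a) ≡ v i a
  vertex-combine i a = cong (uncurry v) (Fin.remQuot-combine i a)

  vertex-injective : Injective _≡_ _≡_ vertex
  vertex-injective {p} {q} vp≡vq = begin
    p                                          ≡⟨ Fin.combine-remQuot {6} 2 p ⟨
    uncurry combine (remQuot {6} 2 p)          ≡⟨ cong (uncurry combine) (v-injective vp≡vq) ⟩
    uncurry combine (remQuot {6} 2 q)          ≡⟨ Fin.combine-remQuot {6} 2 q ⟩
    q                                          ∎

  open Extension vertex vertex-injective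

  D⇒Outside : ∀ {x} → D x → Outside x
  D⇒Outside Dx p = Dx (quotient 2 p) (remainder {6} 2 p)

  Outside⇒D : ∀ {x} → Outside x → D x
  Outside⇒D out i a x≡v = out (combine i a) (trans x≡v (sym (vertex-combine i a)))

  oneNeighbourInEach? : ∀ x → Dec (OneNeighbourInEach x)
  oneNeighbourInEach? x = Fin.all? λ i → degreeInto i x ℕ.≟ 1

  adjacency-symmetric : ∀ (Δ : Graph m) x y → adjacencyℚ Δ x y ≡ adjacencyℚ Δ y x
  adjacency-symmetric Δ x y = cong bit (symmetric Δ x y)

  module _ k c (Γ≋B : induced Γ ≋ B k c) where

    private
      S : Matrix 12 12
      S = R₁₂ ᵀ *ᴹ induced Γ *ᴹ R₁₂

    -- Since π moves C_{i+1} to C_i, the new edges into C_i are read off from the old edges into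
    -- C_{i+1}.
    crossAdj : Fin m → Fin 6 → Fin 2 → Bool
    crossAdj x i a = adj Γ x (v (if does (oneNeighbourInEach? x) then next i else i) a)

    -- The comparison of an entry of S with 1 loses nothing, because `R₁₂-conjugate-binary` makes
    -- every entry 0 or 1.
    switchedAdj : Fin m → Fin m → Maybe (Fin 12) → Maybe (Fin 12) → Bool
    switchedAdj x y (just p) (just q) = does (S p q ℚ.≟ 1ℚ)
    switchedAdj x y (just p) nothing  = uncurry (crossAdj y) (remQuot {6} 2 p)
    switchedAdj x y nothing  (just q) = uncurry (crossAdj x) (remQuot {6} 2 q)
    switchedAdj x y nothing  nothing  = adj Γ x y

    switchedAdj-symmetric : ∀ x y p q → switchedAdj x y p q ≡ switchedAdj y x q p
    switchedAdj-symmetric x y (just p) (just q) =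
      cong (λ s → does (s ℚ.≟ 1ℚ))
        (conjugate-symmetric R₁₂ (λ s t → adjacency-symmetric Γ (vertex s) (vertex t)) p q)
    switchedAdj-symmetric x y (just p) nothing  = refl
    switchedAdj-symmetric x y nothing  (just q) = refl
    switchedAdj-symmetric x y nothing  nothing  = symmetric Γ x y

    switchedAdj-loopless : ∀ x p → switchedAdj x x p p ≡ false
    switchedAdj-loopless x (just p) = cong (λ s → does (s ℚ.≟ 1ℚ)) (R₁₂-conjugate-diagonal (induced Γ) k c Γ≋B p)
    switchedAdj-loopless x nothing  = loopless Γ x

    switch : Graph m
    switch = record
      { adj       = λ x y → switchedAdj x y (index x) (index y)
      ; symmetric = λ x y → switchedAdj-symmetric x y (index x) (index y)
      ; loopless  = λ x → switchedAdj-loopless x (index x)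
      }

    switch-cross : ∀ {x} → D x → ∀ i a → adj switch x (v i a) ≡ crossAdj x i a
    switch-cross {x} Dx i a = begin
      adj switch x (v i a)                                ≡⟨ cong (adj switch x) (vertex-combine i a) ⟨
      adj switch x (vertex (combine i a))                 ≡⟨ cong₂ (switchedAdj x _) (index-outside (D⇒Outside Dx))
                                                                                      (index-vertex (combine i a)) ⟩
      uncurry (crossAdj x) (remQuot {6} 2 (combine i a))  ≡⟨ cong (uncurry (crossAdj x)) (Fin.remQuot-combine i a) ⟩
      crossAdj x i a                                      ∎

    switch-isSwitched : IsSwitched switch
    switch-isSwitched = record
      { outside   = λ {x} {y} Dx Dy →
          cong₂ (switchedAdj x y) (index-outside (D⇒Outside Dx)) (index-outside (D⇒Outside Dy))
      ; switched  = λ {x} Dx one i a → begin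
          adj switch x (v (pred₆ i) a)     ≡⟨ switch-cross Dx (pred₆ i) a ⟩
          crossAdj x (pred₆ i) a           ≡⟨ cong (λ b → adj Γ x (v (if b then next (pred₆ i) else pred₆ i) a))
                                                 (dec-true (oneNeighbourInEach? x) one) ⟩
          adj Γ x (v (next (pred₆ i)) a)   ≡⟨ cong (λ i → adj Γ x (v i a)) (next-pred i) ⟩
          adj Γ x (v i a)                  ∎
      ; unchanged = λ {x} Dx ¬one i a → trans
          (switch-cross Dx i a)
          (cong (λ b → adj Γ x (v (if b then next i else i) a)) (dec-false (oneNeighbourInEach? x) ¬one))
      ; inside    = λ p q → trans
          (cong₂ (λ p′ q′ → bit (switchedAdj (vertex p) (vertex q) p′ q′)) (index-vertex p) (index-vertex q))
          (bit-≟ (R₁₂-conjugate-binary (induced Γ) k c Γ≋B p q))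
      }

  -- Cospectrality of the switched graph.

  module _ (parity : ∀ x → D x → ∀ i j → degreeInto i x % 2 ≡ degreeInto j x % 2)
           {Γ′ : Graph m} (s : IsSwitched Γ′) where

    open IsSwitched s

    cross-columns : ∀ {x} → D x → ∀ i b →
      adjacencyℚ Γ′ x (v i b) ≡ R₁₂-row (λ β a → adj Γ x (v (shift β i) a)) b
    cross-columns {x} Dx i b with oneNeighbourInEach? x
    ... | yes one = begin
      adjacencyℚ Γ′ x (v i b)
        -- The field `switched` describes edges into `pred₆` of a class, so i is written as the
        -- predecessor of `next i`.
        ≡⟨ cong (λ j → adjacencyℚ Γ′ x (v j b)) (pred-next i) ⟨
      adjacencyℚ Γ′ x (v (pred₆ (next i)) b)
        ≡⟨ cong bit (switched Dx one (next i) b) ⟩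
      adjacencyℚ Γ x (v (next i) b)
        ≡⟨ R₁₂-row-odd (λ β a → adj Γ x (v (shift β i) a)) (λ β → one (shift β i)) b ⟩
      R₁₂-row (λ β a → adj Γ x (v (shift β i) a)) b
        ∎
    ... | no ¬one = begin
      adjacencyℚ Γ′ x (v i b)
        ≡⟨ cong bit (unchanged Dx ¬one i b) ⟩
      adjacencyℚ Γ x (v i b)
        ≡⟨ R₁₂-row-even (λ β a → adj Γ x (v (shift β i) a))
             -- If x had exactly one neighbour in class `shift β i`, parity would give it exactly
             -- one in every class, contrary to `¬one`; so both parts are constant.
             (λ β → degree≢1⇒≡ {λ a → adj Γ x (v (shift β i) a)} λ ≡1 → ¬one λ j →
               degree-odd {λ a → adj Γ x (v (shift β i) a)} {λ a → adj Γ x (v j a)}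
                 ≡1 (parity x Dx (shift β i) j)) b ⟩
      R₁₂-row (λ β a → adj Γ x (v (shift β i) a)) b
        ∎

    columns : ∀ {x} q → Outside x →
      adjacencyℚ Γ′ x (vertex q) ≡ ∑[ p < 12 ] (adjacencyℚ Γ x (vertex p) * R₁₂ p q)
    columns {x} q out = combine-all
      (λ q → adjacencyℚ Γ′ x (vertex q) ≡ ∑[ p < 12 ] (adjacencyℚ Γ x (vertex p) * R₁₂ p q))
      (λ i b → begin
        adjacencyℚ Γ′ x (vertex (combine i b))
          ≡⟨ cong (adjacencyℚ Γ′ x) (vertex-combine i b) ⟩
        adjacencyℚ Γ′ x (v i b)
          ≡⟨ cross-columns (Outside⇒D out) i b ⟩
        R₁₂-row (λ β a → adj Γ x (v (shift β i) a)) b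
          ≡⟨ sum-cong-≗ (λ β → sum-cong-≗ λ a →
               cong (λ y → adjacencyℚ Γ x y * (½ * χ β a * χ β b)) (vertex-combine (shift β i) a)) ⟨
        ∑[ β < 2 ] ∑[ a < 2 ] (adjacencyℚ Γ x (vertex (combine (shift β i) a)) * (½ * χ β a * χ β b))
          ≡⟨ sum-R₁₂ (λ p → adjacencyℚ Γ x (vertex p)) i b ⟨
        ∑[ p < 12 ] (adjacencyℚ Γ x (vertex p) * R₁₂ p (combine i b))
          ∎)
      q

    switching-conjugates : Conjugates R₁₂ (adjacencyℚ Γ) (adjacencyℚ Γ′)
    switching-conjugates = record
      { corner  = λ outˣ outʸ → cong bit (outside (Outside⇒D outˣ) (Outside⇒D outʸ))
      ; columns = columns
      ; rows    = λ {y} p outʸ → begin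
          adjacencyℚ Γ′ (vertex p) y
            ≡⟨ adjacency-symmetric Γ′ (vertex p) y ⟩
          adjacencyℚ Γ′ y (vertex p)
            ≡⟨ columns p outʸ ⟩
          ∑[ s < 12 ] (adjacencyℚ Γ y (vertex s) * R₁₂ s p)
            ≡⟨ sum-cong-≗ (λ s → cong (_* R₁₂ s p) (adjacency-symmetric Γ y (vertex s))) ⟩
          ∑[ s < 12 ] (adjacencyℚ Γ (vertex s) y * R₁₂ s p)
            ∎
      ; core    = inside
      }

    -- Every block reduces to the column sums of `R₁₂`, which are 1; the core uses them once on each
    -- side.
    allOnes-conjugates : Conjugates R₁₂ allOnes allOnes
    allOnes-conjugates = record
      { corner  = λ _ _ → refl
      ; columns = λ q _ → sym (R₁₂-columnSum q)
      ; rows    = λ p _ → sym (R₁₂-columnSum p)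
      ; core    = λ p q → sym (trans
          (sum-cong-≗ λ t → cong (_* R₁₂ t q) (trans
            (sum-cong-≗ λ s → ℚ.*-comm (R₁₂ s p) 1ℚ)
            (R₁₂-columnSum p)))
          (R₁₂-columnSum q))
      }

    switching-cospectral : Γ ℝ-Cospectral Γ′
    -- With mk⇔, unification would compare setoids on HasMultiplicity and unfold the reals.
    switching-cospectral r λ₀ k = record
      { to        = to
      ; from      = from
      ; to-cong   = cong to
      ; from-cong = cong from
      }
      where
      open ScalarExtension ℝ-commutativeRing fromℚ-isRingHomomorphism
      module MP = MatrixProperties ℝ-commutativeRing

      Γ+rJ Γ′+rJ : Mℝ.Matrix m m
      Γ+rJ = adjacencyℝ Γ Mℝ.+ᴹ r Mℝ.·ᴹ Mℝ.allOnes
      Γ′+rJ = adjacencyℝ Γ′ Mℝ.+ᴹ r Mℝ.·ᴹ Mℝ.allOnes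

      similar : MP.Similar Γ+rJ Γ′+rJ
      similar = orthogonal⇒similar
        {A = adjacencyℚ Γ} {A′ = adjacencyℚ Γ′} {Q = extend R₁₂} r
        (extend-orthogonal R₁₂ R₁₂ᵀR₁₂≋δ) (extend-orthogonalʳ R₁₂ R₁₂R₁₂ᵀ≋δ)
        (extend-conjugates switching-conjugates) (extend-conjugates allOnes-conjugates)
        -- Entry by entry, both sides are the same sequence of rationals.
        (λ _ _ → pointwise λ _ → refl) (λ _ _ → pointwise λ _ → refl)

      to : Mℝ.HasMultiplicity Γ+rJ λ₀ k → Mℝ.HasMultiplicity Γ′+rJ λ₀ k
      to = MP.similar⇒hasMultiplicity similar

      from : Mℝ.HasMultiplicity Γ′+rJ λ₀ k → Mℝ.HasMultiplicity Γ+rJ λ₀ k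
      from = MP.similar⇒hasMultiplicity (MP.similar-sym similar)

theorem23 : ∀ (m : ℕ) (Γ : Graph m) (v : Fin 6 → Fin 2 → Fin m) →
    let open Switching Γ v in
    Injective _≡_ _≡_ (uncurry v) →
    (∀ x → D x → ∀ i j → degreeInto i x % 2 ≡ degreeInto j x % 2) →
    (∃[ k ] ∃[ c ] (∀ p q → induced Γ p q ≡ B k c p q)) →
    (∃[ Γ′ ] IsSwitched Γ′) × (∀ Γ′ → IsSwitched Γ′ → Γ ℝ-Cospectral Γ′)
theorem23 m Γ v v-injective parity (k , c , Γ≋B) =
  (switch Γ v v-injective k c Γ≋B , switch-isSwitched Γ v v-injective k c Γ≋B) ,
  λ Γ′ → switching-cospectral Γ v v-injective parity
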